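{- Let $F$ be a star forest with $r>1$ components, $p$ vertices and $q=p-r$ edges. Let $t=(p-1)(q-1)+1$ and $\beta(k,l,n)=k\,2^{kl-3}(10k)^{2\alpha(n)^{kl-4}+8\alpha(n)^{kl-5}}$. Then: (1) $\mathrm{gex}(F,n)<(r-1)n+n\cdot\beta(r,2q,n)$ for all $n$; (2) $\mathrm{ex}_e(F,n)\ll n\cdot\beta(r,2tq,n)^3$; (3) $\mathrm{ex}_i(F,n)\ll n\cdot\beta(r,2tq,n)^3$.
   Context: A star forest is a simple graph $F$ whose vertex set is $A\cup B$ with $A<B$ (every element of $A$ smaller than every element of $B$), every vertex of $B$ has degree 1, and every edge joins $A$ and $B$ (so components are stars whose centres precede all leaves). A hypergraph $H=(E_i:i\in I)$ is a finite list of finite nonempty subsets of $\mathbb{N}$; simple if edges are pairwise distinct; $v(H)=|\bigcup_iE_i|$, $e(H)=|I|$, $i(H)=\sum_i|E_i|$. $H$ contains $H'=(E'_i:i\in I')$ ($H\succ H'$) if there exist an increasing injection $\phi:\bigcup H'\to\bigcup H$ and an injection $f:I'\to I$ with $v\in E'_i\Rightarrow\phi(v)\in E_{f(i)}$. $\mathrm{ex}_e(F,n)$ (resp. $\mathrm{ex}_i(F,n)$) is the maximum of $e(H)$ (resp. $i(H)$) over simple hypergraphs $H$ with $v(H)\le n$ and $H\not\succ F$; $\mathrm{gex}(F,n)$ is the maximum of $e(G)$ over simple graphs $G$ with at most $n$ vertices and $G\not\succ F$. Ackermann function: $F_1(n)=2n$, $F_{i+1}(n)=F_i(F_i(\cdots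 F_i(1)\cdots))$ ($n$ iterations), $A(n)=F_n(n)$, $\alpha(n)=\min\{m:A(m)\ge n\}$. $f\ll g$ means $|f(n)|<c|g(n)|$ for a constant $c>0$ and all large $n$. -}

module Defs where

open import Data.Nat using (ℕ; zero; suc; _+_; _*_; _∸_; _^_; _≤_; _<_; _≟_)
open import Data.List using (List; []; _∷_; length; concat; map; deduplicate; lookup)
open import Data.Nat.ListAction using (sum)
open import Data.List.Membership.Propositional using (_∈_)
open import Data.List.Relation.Unary.All using (All)
open import Data.List.Relation.Unary.Any using (Any)
open import Data.List.Relation.Unary.AllPairs using (AllPairs)
open import Data.List.Relation.Unary.Linked using (Linked)
open import Data.Fin using (Fin)
open import Data.Product using (Σ; _×_)
open import Data.Sum using (_⊎_)
open import Function.Definitions using (Injective)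
open import Relation.Binary.PropositionalEquality using (_≡_; _≢_)

-- Hypergraphs on ℕ
-- An edge (finite nonempty subset of ℕ) is represented canonically by
-- its strictly increasing list of elements.  A hypergraph is a finite
-- list of edges; its index set I is Fin (length H).

IsEdge : List ℕ → Set
IsEdge E = Linked _<_ E × (E ≢ [])

Hypergraph : List (List ℕ) → Set
Hypergraph H = All IsEdge H

Simple : List (List ℕ) → Set
Simple H = AllPairs _≢_ H

IsGraph : List (List ℕ) → Set
IsGraph H = All (λ E → length E ≡ 2) H

vH : List (List ℕ) → ℕ
vH H = length (deduplicate _≟_ (concat H))

eH : List (List ℕ) → ℕ
eH H = length H

iH : List (List ℕ) → ℕ
iH H = sum (map length H)

InU : ℕ → List (List ℕ) → Set
InU v H = Any (v ∈_) H

_≻_ : List (List ℕ) → List (List ℕ) → Set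
H ≻ H' =
  Σ (ℕ → ℕ) λ φ →
    (∀ u w → InU u H' → InU w H' → u < w → φ u < φ w) ×
    (∀ u → InU u H' → InU (φ u) H) ×
    Σ (Fin (length H') → Fin (length H)) λ f →
      Injective _≡_ _≡_ f ×
      (∀ i v → v ∈ lookup H' i → φ v ∈ lookup H (f i))

-- Star forests
-- Vertex set A ∪ B (A, B listed strictly increasingly), A < B, each
-- b ∈ B is joined to exactly one vertex  centre b ∈ A, and these are all
-- the edges.  The components are exactly the stars centred at the
-- vertices of A, so the number of components is r = |A|.

record StarForest : Set where
  field
    A : List ℕ
    B : List ℕ
    A-sorted : Linked _<_ A
    B-sorted : Linked _<_ B
    A<B : ∀ a b → a ∈ A → b ∈ B → a < b
    centre : ℕ → ℕ
    centre∈A : ∀ b → b ∈ B → centre b ∈ A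

  edges : List (List ℕ)
  edges = map (λ b → centre b ∷ b ∷ []) B

  r : ℕ
  r = length A

  p : ℕ
  p = length A + length B

  q : ℕ
  q = length B

  t : ℕ
  t = (p ∸ 1) * (q ∸ 1) + 1

iter : ℕ → (ℕ → ℕ) → ℕ → ℕ
iter zero    g x = x
iter (suc k) g x = g (iter k g x)

-- Fs i = F_{i+1}
Fs : ℕ → ℕ → ℕ
Fs zero    n = 2 * n
Fs (suc i) n = iter n (Fs i) 1

-- A(m) = F_m(m)  (only used for m ≥ 1)
Ack : ℕ → ℕ
Ack m = Fs (m ∸ 1) m

IsAlpha : ℕ → ℕ → Set
IsAlpha n a = (1 ≤ a) × (n ≤ Ack a) × (∀ m → 1 ≤ m → m < a → Ack m < n)

-- Positive real numbers of the form  (coef / den) · base ^ (num / dnm)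
-- (den, dnm ≥ 1), represented exactly by natural-number data.

record PowExpr : Set where
  constructor pow
  field
    coef : ℕ
    den  : ℕ
    base : ℕ
    num  : ℕ
    dnm  : ℕ

-- β(k,l,n) = k 2^{kl-3} (10k)^{2α^{kl-4} + 8α^{kl-5}}
--          = (k 2^{kl∸3} / 2^{3∸kl}) · (10k)^{(2α+8) α^{kl∸5} / α^{5∸kl}}
-- where a = α(n) ≥ 1.
β : ℕ → ℕ → ℕ → PowExpr
β k l a = pow (k * 2 ^ (k * l ∸ 3)) (2 ^ (3 ∸ k * l)) (10 * k)
              ((2 * a + 8) * a ^ (k * l ∸ 5)) (a ^ (5 ∸ k * l))

scale : ℕ → PowExpr → PowExpr
scale c (pow co d b e D) = pow (c * co) d b e D

cube : PowExpr → PowExpr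
cube (pow co d b e D) = pow (co ^ 3) (d ^ 3) b (3 * e) D

-- x < s + X   (exact, for dnm ≥ 1, den ≥ 1):
-- either x < s, or ((x - s)·den)^dnm < coef^dnm · base^num
LtPlus : ℕ → ℕ → PowExpr → Set
LtPlus x s (pow co d b e D) = (x < s) ⊎ (((x ∸ s) * d) ^ D < co ^ D * b ^ e)

{-# OPTIONS --safe #-}

-- Colour a pair x < y by an edge of the hypergraph containing both. If the resulting shadow graph
-- has many edges then, read as a sequence of blocks (the lower neighbours of each vertex), it
-- contains a formation: r letters occurring jointly in each of many consecutive groups of blocks.
-- Sending the centres to the r letters and choosing the leaves greedily from successive groups, so
-- that all colours are distinct, embeds the star forest.
--
-- Sequences without such formations are bounded by the usual Ackermann recursion. Cut the sequence
-- into intervals: letters confined to one interval are handled by induction on the length; in a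
-- single interval, the other letters which occurred earlier, and those which occur later, admit
-- formations with one round fewer only; and contracting the intervals to single blocks bounds how
-- often these letters change interval.
--
-- For hypergraphs, every edge is cut into p-element pieces. A piece arises from at most q edges,
-- since otherwise its p vertices carry a copy of the star forest, and pieces are cliques of the
-- shadow graph, whose number is controlled by the density of its induced subgraphs.
module Submission where

open import Defs
open import Data.Nat
open import Data.Nat.Properties
open import Data.Nat.ListAction using (sum)
open import Data.Nat.ListAction.Properties using (sum-++)
open import Data.Nat.Tactic.RingSolver using (solve-∀)
open import Data.Fin using (Fin; zero; suc)
import Data.Fin.Properties as Fin
open import Data.List hiding (sum; find; _∷ʳ_)
open import Data.List.Properties hiding (sum-++)
open import Data.List.Extrema.Nat using (max; xs≤max)
open import Data.List.Membership.Propositional using (_∈_; _∉_; lose; find)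
open import Data.List.Membership.Propositional.Properties
  using ( ∈-lookup; ∈-filter⁺; ∈-filter⁻; ∈-∃++; ∈-deduplicate⁺; ∈-concatMap⁻; ∈-concatMap⁺
        ; ∈-concat⁺′; ∈-++⁺ˡ; ∈-++⁺ʳ; ∈-++⁻; ∈-upTo⁺; ∈-map⁺; ∈-map⁻)
open import Data.List.Membership.DecPropositional _≟_ using (_∈?_)
open import Data.List.Relation.Unary.All as All using (All; []; _∷_)
import Data.List.Relation.Unary.All.Properties as All
open import Data.List.Relation.Unary.Any as Any using (Any; here; there; any?)
import Data.List.Relation.Unary.Any.Properties as Any
open import Data.List.Relation.Unary.AllPairs as AllPairs using (AllPairs; []; _∷_)
import Data.List.Relation.Unary.AllPairs.Properties as AllPairs
open import Data.List.Relation.Unary.Linked using (Linked)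
import Data.List.Relation.Unary.Linked.Properties as Linked
import Data.List.Relation.Unary.Unique.Propositional.Properties as Unique
open import Data.List.Relation.Binary.Pointwise using (Pointwise; []; _∷_; Pointwise-length)
open import Data.List.Relation.Binary.Sublist.Propositional
  using (_⊆_; []; _∷_; _∷ʳ_; ⊆-refl; ⊆-trans; minimum; from∈)
open import Data.List.Relation.Binary.Sublist.Propositional.Properties
  using (filter-⊆; take-⊆; All-resp-⊆; Any-resp-⊆; ++⁺; length-mono-≤)
open import Data.Product using (Σ; ∃₂; _×_; _,_; proj₁; proj₂)
open import Data.Sum using (_⊎_; inj₁; inj₂)
open import Function using (_∘_; id)
open import Function.Definitions using (Injective)
open import Relation.Nullary using (¬_; Dec; yes; no; contradiction)
open import Relation.Nullary.Decidable using (¬?; _×-dec_; decidable-stable)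
open import Relation.Unary using (Decidable)
import Relation.Binary as B
open import Relation.Binary.PropositionalEquality

private variable
  A Blk : Set

-- Finite sums and counting in lists.

∑ : (A → ℕ) → List A → ℕ
∑ f xs = sum (map f xs)

∑-mono : (f g : A → ℕ) (xs : List A) →
  (∀ P x S → xs ≡ P ++ x ∷ S → f x ≤ g x) → ∑ f xs ≤ ∑ g xs
∑-mono f g []       h = z≤n
∑-mono f g (x ∷ xs) h =
  +-mono-≤ (h [] x xs refl) (∑-mono f g xs λ P y S eq → h (x ∷ P) y S (cong (x ∷_) eq))

∑-cong : {f g : A → ℕ} (xs : List A) → (∀ x → f x ≡ g x) → ∑ f xs ≡ ∑ g xs
∑-cong xs h = cong sum (map-cong h xs)

∑-+ : (f g : A → ℕ) (xs : List A) → ∑ (λ x → f x + g x) xs ≡ ∑ f xs + ∑ g xs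
∑-+ f g []       = refl
∑-+ f g (x ∷ xs) rewrite ∑-+ f g xs = shuffle (f x) (g x) (∑ f xs) (∑ g xs)
  where
  shuffle : ∀ a b c d → a + b + (c + d) ≡ a + c + (b + d)
  shuffle = solve-∀

∑-* : (c : ℕ) (f : A → ℕ) (xs : List A) → ∑ (λ x → c * f x) xs ≡ c * ∑ f xs
∑-* c f []       = sym (*-zeroʳ c)
∑-* c f (x ∷ xs) rewrite ∑-* c f xs = sym (*-distribˡ-+ c (f x) (∑ f xs))

∑-1 : (xs : List A) → ∑ (λ _ → 1) xs ≡ length xs
∑-1 []       = refl
∑-1 (x ∷ xs) = cong suc (∑-1 xs)

∑-concat : (f : A → ℕ) (Z : List (List A)) → ∑ f (concat Z) ≡ ∑ (∑ f) Z
∑-concat f []      = refl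
∑-concat f (I ∷ Z) = begin
  sum (map f (I ++ concat Z))          ≡⟨ cong sum (map-++ f I (concat Z)) ⟩
  sum (map f I ++ map f (concat Z))    ≡⟨ sum-++ (map f I) _ ⟩
  ∑ f I + ∑ f (concat Z)               ≡⟨ cong (∑ f I +_) (∑-concat f Z) ⟩
  ∑ f I + ∑ (∑ f) Z                    ∎
  where open ≡-Reasoning

∑-length-concat : (Z : List (List A)) → ∑ length Z ≡ length (concat Z)
∑-length-concat Z = begin
  ∑ length Z            ≡⟨ ∑-cong Z (λ I → sym (∑-1 I)) ⟩
  ∑ (∑ (λ _ → 1)) Z     ≡⟨ sym (∑-concat _ Z) ⟩
  ∑ (λ _ → 1) (concat Z) ≡⟨ ∑-1 (concat Z) ⟩
  length (concat Z)     ∎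
  where open ≡-Reasoning

# : {P : A → Set} → Decidable P → List A → ℕ
# P? xs = length (filter P? xs)

ind : {P : Set} → Dec P → ℕ
ind (yes _) = 1
ind (no _)  = 0

#-∷ : {P : A → Set} (P? : Decidable P) (x : A) (xs : List A) → # P? (x ∷ xs) ≡ ind (P? x) + # P? xs
#-∷ P? x xs with P? x
... | yes _ = refl
... | no _  = refl

#≡∑ : {P : A → Set} (P? : Decidable P) (xs : List A) → # P? xs ≡ ∑ (ind ∘ P?) xs
#≡∑ P? []       = refl
#≡∑ P? (x ∷ xs) = trans (#-∷ P? x xs) (cong (ind (P? x) +_) (#≡∑ P? xs))

#-++ : {P : A → Set} (P? : Decidable P) (xs ys : List A) → # P? (xs ++ ys) ≡ # P? xs + # P? ys
#-++ P? xs ys = trans (cong length (filter-++ P? xs ys)) (length-++ (filter P? xs))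

#-split : {P Q : A → Set} (P? : Decidable P) (Q? : Decidable Q) (xs : List A) →
  # P? xs ≡ # P? (filter Q? xs) + # P? (filter (¬? ∘ Q?) xs)
#-split P? Q? []       = refl
#-split P? Q? (x ∷ xs) with Q? x
... | yes _ rewrite #-∷ P? x xs | #-∷ P? x (filter Q? xs) | #-split P? Q? xs =
  sym (+-assoc (ind (P? x)) _ _)
... | no _ rewrite #-∷ P? x xs | #-∷ P? x (filter (¬? ∘ Q?) xs) | #-split P? Q? xs =
  shuffle (ind (P? x)) (# P? (filter Q? xs)) _
  where
  shuffle : ∀ a b c → a + (b + c) ≡ b + (a + c)
  shuffle = solve-∀

length-split : {Q : A → Set} (Q? : Decidable Q) (xs : List A) →
  length xs ≡ length (filter Q? xs) + length (filter (¬? ∘ Q?) xs)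
length-split Q? []       = refl
length-split Q? (x ∷ xs) with Q? x
... | yes _ = cong suc (length-split Q? xs)
... | no _  = trans (cong suc (length-split Q? xs)) (sym (+-suc _ _))

#-absorb : {P Q : A → Set} (P? : Decidable P) (Q? : Decidable Q) (xs : List A) → (∀ x → P x → Q x) →
  # P? (filter Q? xs) ≡ # P? xs
#-absorb P? Q? []       h = refl
#-absorb P? Q? (x ∷ xs) h with Q? x
... | yes _ = trans (#-∷ P? x _) (trans (cong (ind (P? x) +_) (#-absorb P? Q? xs h)) (sym (#-∷ P? x xs)))
... | no ¬q with P? x
...   | yes p = contradiction (h x p) ¬q
...   | no _  = #-absorb P? Q? xs h

-- Incidences between letters and blocks, and formations.

inc : {M : A → Blk → Set} → B.Decidable M → List A → List Blk → ℕ
inc M? X Y = ∑ (λ y → # (λ x → M? x y) X) Y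

inc-transpose : {M : A → Blk → Set} (M? : B.Decidable M) (X : List A) (Y : List Blk) →
  inc M? X Y ≡ ∑ (λ x → # (M? x) Y) X
inc-transpose M? X []      = sym (trans (∑-cong X (λ _ → refl)) (∑-0 X))
  where
  ∑-0 : (xs : List A) → ∑ (λ _ → 0) xs ≡ 0
  ∑-0 []       = refl
  ∑-0 (_ ∷ xs) = ∑-0 xs
inc-transpose M? X (y ∷ Y) = begin
  # (λ x → M? x y) X + inc M? X Y
    ≡⟨ cong₂ _+_ (#≡∑ (λ x → M? x y) X) (inc-transpose M? X Y) ⟩
  ∑ (λ x → ind (M? x y)) X + ∑ (λ x → # (M? x) Y) X
    ≡⟨ sym (∑-+ _ _ X) ⟩
  ∑ (λ x → ind (M? x y) + # (M? x) Y) X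
    ≡⟨ ∑-cong X (λ x → sym (#-∷ (M? x) y Y)) ⟩
  ∑ (λ x → # (M? x) (y ∷ Y)) X ∎
  where open ≡-Reasoning

inc-split : {M : A → Blk → Set} (M? : B.Decidable M) {Q : A → Set} (Q? : Decidable Q) (X : List A) (Y : List Blk) →
  inc M? X Y ≡ inc M? (filter Q? X) Y + inc M? (filter (¬? ∘ Q?) X) Y
inc-split M? Q? X Y =
  trans (∑-cong Y (λ y → #-split (λ x → M? x y) Q? X)) (∑-+ _ _ Y)

inc-≤-* : {M : A → Blk → Set} (M? : B.Decidable M) (X : List A) (Y : List Blk) →
  inc M? X Y ≤ length X * length Y
inc-≤-* M? X Y = begin
  inc M? X Y                    ≤⟨ ∑-mono _ _ Y (λ _ y _ _ → length-filter (λ x → M? x y) X) ⟩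
  ∑ (λ _ → length X) Y          ≡⟨ ∑-cong Y (λ _ → sym (*-identityʳ (length X))) ⟩
  ∑ (λ _ → length X * 1) Y      ≡⟨ ∑-* (length X) _ Y ⟩
  length X * ∑ (λ _ → 1) Y      ≡⟨ cong (length X *_) (∑-1 Y) ⟩
  length X * length Y           ∎
  where open ≤-Reasoning

module _ {M : A → Blk → Set} (M? : B.Decidable M) where

  -- This is also the membership relation of the contracted sequence, whose blocks are whole
  -- intervals; `inc` and `Rounds` are generic in `M` so that they apply to it as well.
  Occ : A → List Blk → Set
  Occ x I = Any (M x) I

  occ? : B.Decidable Occ
  occ? x = any? (M? x)

  -- Letters that do not occur in `Y` have no incidences there. Each interval can therefore be
  -- charged only for the letters it contains.
  inc-absorb : (Y : List Blk) (X : List A) →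
    inc M? (filter (λ x → occ? x Y) X) Y ≡ inc M? X Y
  inc-absorb Y X = cong sum (go Y λ y∈ → y∈)
    where
    go : ∀ Y′ → (∀ {y} → y ∈ Y′ → y ∈ Y) →
      map (λ y → # (λ x → M? x y) (filter (λ x → occ? x Y) X)) Y′ ≡ map (λ y → # (λ x → M? x y) X) Y′
    go []       s = refl
    go (y ∷ Y′) s = cong₂ _∷_
      (#-absorb (λ x → M? x y) (λ x → occ? x Y) X (λ x m → lose (s (here refl)) m))
      (go Y′ (s ∘ there))

  inc-concat : (X : List A) (Z : List (List Blk)) → inc M? X (concat Z) ≡ ∑ (inc M? X) Z
  inc-concat X Z = ∑-concat _ Z

-- Within a round the letters may occur in any order, even in one common block. `done` accepts
-- arbitrary leftover blocks, so rounds survive appending blocks.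
data Rounds (M : A → Blk → Set) (xs : List A) : ℕ → List Blk → Set where
  done : ∀ {Y} → Rounds M xs zero Y
  more : ∀ {s} Y₁ Y₂ → All (λ x → Any (M x) Y₁) xs → Rounds M xs s Y₂ →
         Rounds M xs (suc s) (Y₁ ++ Y₂)

module _ {M : A → Blk → Set} {xs : List A} where

  rounds-++ʳ : ∀ {s Y} Y′ → Rounds M xs s Y → Rounds M xs s (Y ++ Y′)
  rounds-++ʳ Y′ done             = done
  rounds-++ʳ Y′ (more Y₁ Y₂ p R) =
    subst (Rounds M xs _) (sym (++-assoc Y₁ Y₂ Y′)) (more Y₁ (Y₂ ++ Y′) p (rounds-++ʳ Y′ R))

  rounds-++ˡ : ∀ {s Y} Y′ → Rounds M xs s Y → Rounds M xs s (Y′ ++ Y)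
  rounds-++ˡ Y′ done             = done
  rounds-++ˡ Y′ (more Y₁ Y₂ p R) =
    subst (Rounds M xs _) (++-assoc Y′ Y₁ Y₂) (more (Y′ ++ Y₁) Y₂ (All.map (Any.++⁺ʳ Y′) p) R)

  rounds-snoc : ∀ {s Y} Y′ → Rounds M xs s Y → All (λ x → Any (M x) Y′) xs →
    Rounds M xs (suc s) (Y ++ Y′)
  rounds-snoc {Y = Y} Y′ done p =
    rounds-++ˡ Y (subst (Rounds M xs 1) (++-identityʳ Y′) (more Y′ [] p done))
  rounds-snoc Y′ (more Y₁ Y₂ q R) p =
    subst (Rounds M xs _) (sym (++-assoc Y₁ Y₂ Y′)) (more Y₁ (Y₂ ++ Y′) q (rounds-snoc Y′ R p))

  -- Occurring in an interval means belonging to one of its blocks, so a formation of the contracted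
  -- sequence unfolds, with the same letters and number of rounds, to one of the original sequence.
  rounds-concat : ∀ {s Z} → Rounds (λ x → Any (M x)) xs s Z → Rounds M xs s (concat Z)
  rounds-concat done             = done
  rounds-concat (more Z₁ Z₂ p R) =
    subst (Rounds M xs _) (concat-++ Z₁ Z₂)
      (more (concat Z₁) (concat Z₂) (All.map Any.concat⁺ p) (rounds-concat R))

Formation : (M : A → Blk → Set) → ℕ → ℕ → List A → List Blk → Set
Formation M r s X Y = Σ (List _) λ xs → xs ⊆ X × length xs ≡ r × Rounds M xs s Y

module _ {M : A → Blk → Set} {r s : ℕ} {X : List A} where

  formation-⊆ : ∀ {X′ Y} → X′ ⊆ X → Formation M r s X′ Y → Formation M r s X Y
  formation-⊆ τ (xs , σ , l , R) = xs , ⊆-trans σ τ , l , R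

  formation-infix : ∀ P {Y} S → Formation M r s X Y → Formation M r s X (P ++ Y ++ S)
  formation-infix P S (xs , σ , l , R) = xs , σ , l , rounds-++ˡ P (rounds-++ʳ S R)

  -- The prefix `P` itself serves as one more round in front. `formation-append` is the mirror
  -- image, with `S` as the last round.
  formation-prepend : ∀ {X′} P {Y} S → X′ ⊆ X → All (λ x → Any (M x) P) X′ →
    Formation M r s X′ Y → Formation M r (suc s) X (P ++ Y ++ S)
  formation-prepend P S τ p (xs , σ , l , R) =
    xs , ⊆-trans σ τ , l , more P _ (All-resp-⊆ σ p) (rounds-++ʳ S R)

  formation-append : ∀ {X′} P {Y} S → X′ ⊆ X → All (λ x → Any (M x) S) X′ →
    Formation M r s X′ Y → Formation M r (suc s) X (P ++ Y ++ S)
  formation-append P S τ p (xs , σ , l , R) =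
    xs , ⊆-trans σ τ , l , rounds-++ˡ P (rounds-snoc S R (All-resp-⊆ σ p))

-- Cutting a sequence into intervals.

chunk : ℕ → List A → List A × List (List A)
chunk L []      = [] , []
chunk L (y ∷ Y) with chunk L Y
... | I , Z with length I <? L
...   | yes _ = y ∷ I , Z
...   | no _  = y ∷ [] , I ∷ Z

chunks : ℕ → List A → List (List A)
chunks L Y = proj₁ (chunk L Y) ∷ proj₂ (chunk L Y)

module _ {L : ℕ} (1≤L : 1 ≤ L) where

  concat-chunks : (Y : List A) → concat (chunks L Y) ≡ Y
  concat-chunks []      = refl
  concat-chunks (y ∷ Y) with chunk L Y | concat-chunks Y
  ... | I , Z | ih with length I <? L
  ...   | yes _ = cong (y ∷_) ih
  ...   | no _  = cong (y ∷_) ih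

  length-head-chunk : (Y : List A) → length (proj₁ (chunk L Y)) ≤ L
  length-head-chunk []      = z≤n
  length-head-chunk (y ∷ Y) with chunk L Y
  ... | I , Z with length I <? L
  ...   | yes l = l
  ...   | no _  = 1≤L

  head-chunk-nonempty : (Y : List A) → 1 ≤ length Y → 1 ≤ length (proj₁ (chunk L Y))
  head-chunk-nonempty (y ∷ Y) _ with chunk L Y
  ... | I , Z with length I <? L
  ...   | yes _ = s≤s z≤n
  ...   | no _  = s≤s z≤n

  -- Grouping proceeds from the right and opens a new interval only when the current one is full, so
  -- only the leftmost interval can fall short of `L`.
  length-tail-chunks : (Y : List A) → All (λ I → length I ≡ L) (proj₂ (chunk L Y))
  length-tail-chunks []      = []
  length-tail-chunks (y ∷ Y) with chunk L Y | length-head-chunk Y | length-tail-chunks Y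
  ... | I , Z | l | ls with length I <? L
  ...   | yes _ = ls
  ...   | no ¬l = ≤-antisym l (≮⇒≥ ¬l) ∷ ls

  length-chunks : (Y : List A) → All (λ I → length I ≤ L) (chunks L Y)
  length-chunks Y = length-head-chunk Y ∷ All.map ≤-reflexive (length-tail-chunks Y)

  #chunks : (Y : List A) → length (proj₁ (chunk L Y)) + length (proj₂ (chunk L Y)) * L ≡ length Y
  #chunks []      = refl
  #chunks (y ∷ Y) with chunk L Y | length-head-chunk Y | #chunks Y
  ... | I , Z | l | ih with length I <? L
  ...   | yes _ = cong suc ih
  ...   | no ¬l = cong suc (trans (cong (_+ length Z * L) (≤-antisym (≮⇒≥ ¬l) l)) ih)

-- The Ackermann hierarchy and the shape of the bounds.

Fs-suc-pos : ∀ k j → 1 ≤ Fs (suc k) j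
Fs-pos : ∀ k j → 1 ≤ j → 1 ≤ Fs k j

Fs-pos zero    (suc j) _ = s≤s z≤n
Fs-pos (suc k) j       _ = Fs-suc-pos k j

Fs-suc-pos k zero    = s≤s z≤n
Fs-suc-pos k (suc j) = Fs-pos k _ (Fs-suc-pos k j)

^-distribʳ-* : ∀ e m n → (m * n) ^ e ≡ m ^ e * n ^ e
^-distribʳ-* zero    m n = refl
^-distribʳ-* (suc e) m n rewrite ^-distribʳ-* e m n = [m*n]*[o*p]≡[m*o]*[n*p] m n (m ^ e) (n ^ e)

-- Lengths are compared with `E`-th powers for a fixed `E` that dominates `s`: an interval of length
-- `N ^ E` then pays for the factor `N ^ s` arising in the bound for the contracted sequence.
module Bounds (r E : ℕ) where

  -- Indexing: the excluded formations have s + 1 rounds.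
  Bound : (s k C : ℕ) → Set₁
  Bound s k C = ∀ {A Blk : Set} {M : A → Blk → Set} (M? : B.Decidable M) X Y j →
    ¬ Formation M r (suc s) X Y → length Y ≤ Fs k j ^ E →
    inc M? X Y ≤ C * (length X + j ^ s * length Y)

  -- What one step of the recursion needs to know about the contracted
  -- sequence, whose Z blocks stand for intervals of length N ^ E.
  ContractedBound : (s k D : ℕ) → Set₁
  ContractedBound s k D = ∀ {A Blk : Set} {M : A → Blk → Set} (M? : B.Decidable M) X Z N → 1 ≤ N →
    ¬ Formation M r (suc s) X Z → length Z ≤ Fs k N ^ E → length Z * N ^ E ≤ 2 * Fs k N ^ E →
    inc M? X Z ≤ D * (length X + N ^ E * length Z)

  -- Any `r` letters occurring in `Y` form a single round, so fewer than `r` letters occur and every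
  -- block meets fewer than `r` of them.
  bound-0 : ∀ k → Bound 0 k r
  bound-0 k {M = M} M? X Y j ¬F _ = begin
    inc M? X Y                  ≡⟨ sym (inc-absorb M? Y X) ⟩
    inc M? X′ Y                 ≤⟨ inc-≤-* M? X′ Y ⟩
    length X′ * length Y        ≤⟨ *-monoˡ-≤ (length Y) (<⇒≤ short) ⟩
    r * length Y                ≤⟨ *-monoʳ-≤ r (≤-trans (≤-reflexive (sym (*-identityˡ _))) (m≤n+m _ (length X))) ⟩
    r * (length X + 1 * length Y) ∎
    where
    open ≤-Reasoning
    X′ = filter (λ x → occ? M? x Y) X
    short : length X′ < r
    short = ≰⇒> λ r≤ → ¬F
      ( take r X′
      , ⊆-trans (take-⊆ r X′) (filter-⊆ _ X)
      , trans (length-take r X′) (m≤n⇒m⊓n≡m r≤)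
      , subst (Rounds M _ 1) (++-identityʳ Y)
          (more Y [] (All-resp-⊆ (take-⊆ r X′) (All.all-filter (λ x → occ? M? x Y) X)) done) )

  -- `Fs 0` merely doubles, so the contraction has at most `2 ^ suc E` blocks and the trivial
  -- estimate suffices.
  contracted-0 : ∀ s → ContractedBound s 0 (2 ^ suc E)
  contracted-0 s M? X Z N 1≤N _ _ h = begin
    inc M? X Z                ≤⟨ inc-≤-* M? X Z ⟩
    length X * length Z       ≤⟨ *-monoʳ-≤ (length X) few ⟩
    length X * 2 ^ suc E      ≡⟨ *-comm (length X) _ ⟩
    2 ^ suc E * length X      ≤⟨ *-monoʳ-≤ (2 ^ suc E) (m≤m+n _ _) ⟩
    2 ^ suc E * (length X + N ^ E * length Z) ∎
    where
    open ≤-Reasoning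
    instance _ = >-nonZero 1≤N
    instance _ = m^n≢0 N E
    few : length Z ≤ 2 ^ suc E
    few = *-cancelʳ-≤ _ _ (N ^ E) (begin
      length Z * N ^ E      ≤⟨ h ⟩
      2 * (2 * N) ^ E       ≡⟨ cong (2 *_) (^-distribʳ-* E 2 N) ⟩
      2 * (2 ^ E * N ^ E)   ≡⟨ sym (*-assoc 2 (2 ^ E) (N ^ E)) ⟩
      2 ^ suc E * N ^ E     ∎)

  -- From `s ≤ E` the factor `N ^ s` is at most `N ^ E`, the interval length.
  contracted-suc : ∀ {s k C} → s ≤ E → Bound s k C → ContractedBound s k C
  contracted-suc {s} {k} {C} s≤E b M? X Z N 1≤N ¬F l _ = ≤-trans (b M? X Z N ¬F l)
    (*-monoʳ-≤ C (+-monoʳ-≤ (length X) (*-monoˡ-≤ (length Z) (^-monoʳ-≤ N s≤E))))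
    where instance _ = >-nonZero 1≤N

#-pos⇒Any : {A : Set} {P : A → Set} (P? : Decidable P) (xs : List A) → 1 ≤ # P? xs → Any P xs
#-pos⇒Any P? (x ∷ xs) h with P? x
... | yes p = here p
... | no _  = there (#-pos⇒Any P? xs h)

¬Any⇒#≡0 : {A : Set} {P : A → Set} (P? : Decidable P) (xs : List A) → ¬ Any P xs → # P? xs ≡ 0
¬Any⇒#≡0 P? []       h = refl
¬Any⇒#≡0 P? (x ∷ xs) h with P? x
... | yes p = contradiction (here p) h
... | no _  = ¬Any⇒#≡0 P? xs (h ∘ there)

∑-affine : {A : Set} (c w : ℕ) (f g : A → ℕ) (xs : List A) →
  ∑ (λ x → c * (f x + w * g x)) xs ≡ c * (∑ f xs + w * ∑ g xs)
∑-affine c w f g xs = trans (∑-* c _ xs)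
  (cong (c *_) (trans (∑-+ f _ xs) (cong (∑ f xs +_) (∑-* w g xs))))

-- Letters confined to one interval and letters met in several.

module Intervals {A Blk : Set} {M : A → Blk → Set} (M? : B.Decidable M) (X : List A)
  (Z : List (List Blk)) where

  Local : A → Set
  Local x = # (occ? M? x) Z ≤ 1

  local? : Decidable Local
  local? x = # (occ? M? x) Z ≤? 1

  locals globals : List A
  locals  = filter local? X
  globals = filter (¬? ∘ local?) X

  incidences-locals : inc (occ? M?) locals Z ≤ length locals
  incidences-locals = begin
    inc (occ? M?) locals Z        ≡⟨ inc-transpose (occ? M?) locals Z ⟩
    ∑ (λ x → # (occ? M? x) Z) locals ≤⟨ go locals (All.all-filter local? X) ⟩
    length locals                 ∎
    where
    open ≤-Reasoning
    go : ∀ xs → All Local xs → ∑ (λ x → # (occ? M? x) Z) xs ≤ length xs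
    go []       []       = z≤n
    go (x ∷ xs) (p ∷ ps) = +-mono-≤ p (go xs ps)

  in-interval : List A → List Blk → List A
  in-interval X′ I = filter (λ x → occ? M? x I) X′

  old new : List Blk → List Blk → List A
  old P I = filter (λ x → occ? M? x P) (in-interval globals I)
  new P I = filter (λ x → ¬? (occ? M? x P)) (in-interval globals I)

  old⊆X : ∀ P I → old P I ⊆ X
  old⊆X P I = ⊆-trans (filter-⊆ _ _) (⊆-trans (filter-⊆ _ _) (filter-⊆ _ X))

  new⊆X : ∀ P I → new P I ⊆ X
  new⊆X P I = ⊆-trans (filter-⊆ _ _) (⊆-trans (filter-⊆ _ _) (filter-⊆ _ X))

  old-occurs : ∀ P I → All (λ x → Occ M? x P) (old P I)
  old-occurs P I = All.all-filter (λ x → occ? M? x P) (in-interval globals I)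

  -- A global letter occurs in at least two intervals. If none of them precedes `I`, at most one is
  -- `I` itself, and another must follow.
  new-occurs : ∀ P I S → Z ≡ P ++ I ∷ S → All (λ x → Occ M? x (concat S)) (new (concat P) I)
  new-occurs P I S refl = All.zipWith later
    ( All.all-filter (λ x → ¬? (occ? M? x (concat P))) (in-interval globals I)
    , All-resp-⊆ (⊆-trans (filter-⊆ _ (in-interval globals I)) (filter-⊆ _ globals)) (All.all-filter (¬? ∘ local?) X) )
    where
    later : ∀ {x} → (¬ Occ M? x (concat P)) × (¬ Local x) → Occ M? x (concat S)
    later {x} (¬P , ¬l) = Any.concat⁺ (#-pos⇒Any (occ? M? x) S (≰⇒> λ S≤0 → ¬l (begin
      # (occ? M? x) (P ++ I ∷ S)                  ≡⟨ #-++ (occ? M? x) P (I ∷ S) ⟩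
      # (occ? M? x) P + # (occ? M? x) (I ∷ S)     ≡⟨ cong₂ _+_ (¬Any⇒#≡0 (occ? M? x) P (¬P ∘ Any.concat⁺)) (#-∷ (occ? M? x) I S) ⟩
      ind (occ? M? x I) + # (occ? M? x) S         ≤⟨ +-mono-≤ (ind≤1 (occ? M? x I)) S≤0 ⟩
      1                                           ∎)))
      where
      open ≤-Reasoning
      ind≤1 : {P : Set} (d : Dec P) → ind d ≤ 1
      ind≤1 (yes _) = ≤-refl
      ind≤1 (no _)  = z≤n

-- The recursion step.

module _ (r E : ℕ) where
  open Bounds r E

  -- Induction on `j`. With `N = Fs (suc k) j` one has `Fs (suc k) (suc j) = Fs k N`: intervals of
  -- length `N ^ E` fall under the case `j`, and the contraction falls under level `k`. Local
  -- letters contribute `j ^ suc s` and global ones `suc j ^ s` to the coefficient of `length Y`,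
  -- and `suc j ^ s + j ^ suc s ≤ suc j ^ suc s`. The 4 in the constant absorbs two factors 2: old
  -- and new letters each pay for the length of an interval, and the number of intervals is rounded
  -- up.
  bound-suc : ∀ {s k C D} → 1 ≤ C → 1 ≤ D →
    Bound s (suc k) C → ContractedBound (suc s) k D → Bound (suc s) (suc k) (4 * C * D)
  -- Zero iterations give `Fs (suc k) 0 = 1`, so `Y` has at most one block.
  bound-suc {s} {k} {C} {D} 1≤C 1≤D bound contracted M? X Y zero ¬F l = begin
    inc M? X Y                  ≤⟨ inc-≤-* M? X Y ⟩
    length X * length Y         ≤⟨ *-monoʳ-≤ (length X) (≤-trans l (≤-reflexive (^-zeroˡ E))) ⟩
    length X * 1                ≡⟨ *-identityʳ _ ⟩
    length X                    ≤⟨ m≤m+n _ _ ⟩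
    length X + 0 * length Y     ≤⟨ ≤-trans (≤-reflexive (sym (*-identityˡ _))) (*-monoˡ-≤ _ (*-mono-≤ (*-mono-≤ (s≤s {n = 3} z≤n) 1≤C) 1≤D)) ⟩
    4 * C * D * (length X + 0 * length Y) ∎
    where open ≤-Reasoning
  bound-suc {s} {k} {C} {D} 1≤C 1≤D bound contracted {M = M} M? X Y (suc j) ¬F l
    with length Y ≤? Fs (suc k) j ^ E
  ... | yes l′ = ≤-trans (bound-suc {s} {k} {C} {D} 1≤C 1≤D bound contracted M? X Y j ¬F l′)
    (*-monoʳ-≤ (4 * C * D) (+-monoʳ-≤ (length X) (*-monoˡ-≤ (length Y) (^-monoˡ-≤ (suc s) (n≤1+n j)))))
  ... | no ¬l′ = begin
    inc M? X Y
      ≡⟨ inc-split M? local? X Y ⟩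
    inc M? locals Y + inc M? globals Y
      ≤⟨ +-mono-≤ inc-locals inc-globals ⟩
    K * (length locals + j ^ suc s * m) + C * (D * (length globals + 2 * m) + 2 * j ^ s * m)
      ≤⟨ +-monoʳ-≤ (K * (length locals + j ^ suc s * m))
           (absorb C D (length globals) m (j ^ s) (suc j ^ s) 1≤D (^-monoˡ-≤ s (n≤1+n j)) (m^n>0 (suc j) s)) ⟩
    K * (length locals + j ^ suc s * m) + K * (length globals + suc j ^ s * m)
      ≡⟨ collect K (length locals) (length globals) (j ^ suc s) (suc j ^ s) m ⟩
    K * (length locals + length globals + (suc j ^ s + j ^ suc s) * m)
      ≤⟨ *-monoʳ-≤ K (+-mono-≤ (≤-reflexive (sym (length-split local? X)))
           (*-monoˡ-≤ m (+-monoʳ-≤ (suc j ^ s) (*-monoʳ-≤ j (^-monoˡ-≤ s (n≤1+n j)))))) ⟩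
    K * (length X + suc j ^ suc s * m) ∎
    where
    open ≤-Reasoning
    K = 4 * C * D
    m = length Y
    N = Fs (suc k) j
    1≤N = Fs-suc-pos k j
    instance _ = >-nonZero 1≤N
    1≤L : 1 ≤ N ^ E
    1≤L = m^n>0 N E
    Z = chunks (N ^ E) Y
    Y≡ : concat Z ≡ Y
    Y≡ = concat-chunks 1≤L Y
    L<m : N ^ E < m
    L<m = ≰⇒> ¬l′
    open Intervals M? X Z

    collect : ∀ K a b p q m → K * (a + p * m) + K * (b + q * m) ≡ K * (a + b + (q + p) * m)
    collect = solve-∀

    absorb : ∀ C D g m u v → 1 ≤ D → u ≤ v → 1 ≤ v →
      C * (D * (g + 2 * m) + 2 * u * m) ≤ 4 * C * D * (g + v * m)
    absorb C D g m u v 1≤D u≤v 1≤v = begin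
      C * (D * (g + 2 * m) + 2 * u * m)
        ≤⟨ *-monoʳ-≤ C (+-mono-≤ (*-monoʳ-≤ D (+-mono-≤ (m≤n*m g 4) (*-monoʳ-≤ 2 (≤-trans (≤-reflexive (sym (*-identityˡ m))) (*-monoˡ-≤ m 1≤v)))))
             (≤-trans (*-monoˡ-≤ m (*-monoʳ-≤ 2 u≤v)) (≤-trans (≤-reflexive (sym (*-identityˡ _))) (*-monoˡ-≤ (2 * v * m) 1≤D)))) ⟩
      C * (D * (4 * g + 2 * (v * m)) + D * (2 * v * m))
        ≡⟨ eq C D g m v ⟩
      4 * C * D * (g + v * m) ∎
      where
      eq : ∀ C D g m v → C * (D * (4 * g + 2 * (v * m)) + D * (2 * v * m)) ≡ 4 * C * D * (g + v * m)
      eq = solve-∀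

    -- The leftmost interval, possibly incomplete, is counted as full; this costs `N ^ E`, which is
    -- less than `m`.
    #Z*L : length Z * N ^ E ≤ 2 * m
    #Z*L = begin
      N ^ E + length (proj₂ (chunk (N ^ E) Y)) * N ^ E
        ≤⟨ +-mono-≤ (<⇒≤ L<m) (≤-trans (m≤n+m _ _) (≤-reflexive (#chunks 1≤L Y))) ⟩
      m + m ≡⟨ cong (m +_) (sym (+-identityʳ m)) ⟩
      2 * m ∎

    #Z : length Z ≤ m
    #Z = begin
      suc z′                 ≤⟨ s≤s (m≤m*n z′ (N ^ E)) ⟩
      1 + z′ * N ^ E         ≤⟨ +-monoˡ-≤ (z′ * N ^ E) (head-chunk-nonempty 1≤L Y (≤-trans 1≤L (<⇒≤ L<m))) ⟩
      length (proj₁ (chunk (N ^ E) Y)) + z′ * N ^ E ≡⟨ #chunks 1≤L Y ⟩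
      m                      ∎
      where
      z′ = length (proj₂ (chunk (N ^ E) Y))
      instance _ = >-nonZero 1≤L

    infix≡ : ∀ P I S → Z ≡ P ++ I ∷ S → concat P ++ I ++ concat S ≡ Y
    infix≡ P I S eq = trans (concat-++ P (I ∷ S)) (trans (cong concat (sym eq)) Y≡)

    interval-short : ∀ P I S → Z ≡ P ++ I ∷ S → length I ≤ N ^ E
    interval-short P I S eq =
      All.head (All.++⁻ʳ P (subst (All (λ I → length I ≤ N ^ E)) eq (length-chunks 1≤L Y)))

    -- A local letter is charged in one interval at most, so the bounds for `j` on the separate
    -- intervals add up without repetition.
    inc-locals : inc M? locals Y ≤ K * (length locals + j ^ suc s * m)
    inc-locals = begin
      inc M? locals Y
        ≡⟨ trans (cong (inc M? locals) (sym Y≡)) (inc-concat M? locals Z) ⟩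
      ∑ (inc M? locals) Z
        ≤⟨ ∑-mono _ _ Z interval ⟩
      ∑ (λ I → K * (length (in-interval locals I) + j ^ suc s * length I)) Z
        ≡⟨ ∑-affine K (j ^ suc s) _ length Z ⟩
      K * (inc (occ? M?) locals Z + j ^ suc s * ∑ length Z)
        ≤⟨ *-monoʳ-≤ K (+-mono-≤ incidences-locals
             (*-monoʳ-≤ (j ^ suc s) (≤-reflexive (trans (∑-length-concat Z) (cong length Y≡))))) ⟩
      K * (length locals + j ^ suc s * m) ∎
      where
      interval : ∀ P I S → Z ≡ P ++ I ∷ S →
        inc M? locals I ≤ K * (length (in-interval locals I) + j ^ suc s * length I)
      interval P I S eq = ≤-trans (≤-reflexive (sym (inc-absorb M? I locals)))
        (bound-suc {s} {k} {C} {D} 1≤C 1≤D bound contracted M? (in-interval locals I) I j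
          (λ F → ¬F (subst (Formation M r _ X) (infix≡ P I S eq)
            (formation-infix (concat P) (concat S)
              (formation-⊆ (⊆-trans (filter-⊆ _ locals) (filter-⊆ _ X)) F))))
          (interval-short P I S eq))

    inc-globals : inc M? globals Y ≤ C * (D * (length globals + 2 * m) + 2 * j ^ s * m)
    inc-globals = begin
      inc M? globals Y
        ≡⟨ trans (cong (inc M? globals) (sym Y≡)) (inc-concat M? globals Z) ⟩
      ∑ (inc M? globals) Z
        ≤⟨ ∑-mono _ _ Z interval ⟩
      ∑ (λ I → C * (length (in-interval globals I) + 2 * j ^ s * length I)) Z
        ≡⟨ ∑-affine C (2 * j ^ s) _ length Z ⟩
      C * (inc (occ? M?) globals Z + 2 * j ^ s * ∑ length Z)
        ≤⟨ *-monoʳ-≤ C (+-mono-≤ inc-contracted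
             (*-monoʳ-≤ (2 * j ^ s) (≤-reflexive (trans (∑-length-concat Z) (cong length Y≡))))) ⟩
      C * (D * (length globals + 2 * m) + 2 * j ^ s * m) ∎
      where
      -- The numbers of global letters in the intervals sum to the incidence count of the
      -- contraction, where `occ?` decides membership.
      inc-contracted : inc (occ? M?) globals Z ≤ D * (length globals + 2 * m)
      inc-contracted = begin
        inc (occ? M?) globals Z
          ≤⟨ contracted (occ? M?) globals Z N 1≤N
               (λ (xs , τ , lxs , R) → ¬F (xs , ⊆-trans τ (filter-⊆ _ X) , lxs , subst (Rounds M xs _) Y≡ (rounds-concat R)))
               (≤-trans #Z l) (≤-trans #Z*L (*-monoʳ-≤ 2 l)) ⟩
        D * (length globals + N ^ E * length Z)
          ≤⟨ *-monoʳ-≤ D (+-monoʳ-≤ (length globals) (≤-trans (≤-reflexive (*-comm (N ^ E) _)) #Z*L)) ⟩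
        D * (length globals + 2 * m) ∎

      interval : ∀ P I S → Z ≡ P ++ I ∷ S →
        inc M? globals I ≤ C * (length (in-interval globals I) + 2 * j ^ s * length I)
      interval P I S eq = begin
        inc M? globals I
          ≡⟨ sym (inc-absorb M? I globals) ⟩
        inc M? (in-interval globals I) I
          ≡⟨ inc-split M? (λ x → occ? M? x (concat P)) (in-interval globals I) I ⟩
        inc M? (old (concat P) I) I + inc M? (new (concat P) I) I
          ≤⟨ +-mono-≤
               -- Old letters would gain a round from the blocks before `I`, new ones from the
               -- blocks after it; hence both obey the bound for `s`.
               (bound M? (old (concat P) I) I j (λ F → ¬F (subst (Formation M r _ X) (infix≡ P I S eq)
                 (formation-prepend (concat P) (concat S) (old⊆X (concat P) I) (old-occurs (concat P) I) F)))
                 (interval-short P I S eq))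
               (bound M? (new (concat P) I) I j (λ F → ¬F (subst (Formation M r _ X) (infix≡ P I S eq)
                 (formation-append (concat P) (concat S) (new⊆X (concat P) I) (new-occurs P I S eq) F)))
                 (interval-short P I S eq)) ⟩
        C * (length (old (concat P) I) + j ^ s * length I) + C * (length (new (concat P) I) + j ^ s * length I)
          ≡⟨ pool C (length (old (concat P) I)) (length (new (concat P) I)) (j ^ s) (length I) ⟩
        C * (length (old (concat P) I) + length (new (concat P) I) + 2 * j ^ s * length I)
          ≡⟨ cong (λ h → C * (h + 2 * j ^ s * length I)) (sym (length-split (λ x → occ? M? x (concat P)) (in-interval globals I))) ⟩
        C * (length (in-interval globals I) + 2 * j ^ s * length I) ∎
        where
        pool : ∀ C a b u l → C * (a + u * l) + C * (b + u * l) ≡ C * (a + b + 2 * u * l)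
        pool = solve-∀

-- Solving the recursion for the constants.

module _ (r E : ℕ) (1≤r : 1 ≤ r) where
  open Bounds r E

  const : ℕ → ℕ → ℕ
  const zero    k       = r
  const (suc s) zero    = 2 ^ suc E
  const (suc s) (suc k) = 4 * const s (suc k) * const (suc s) k

  1≤const : ∀ s k → 1 ≤ const s k
  1≤const zero    k       = 1≤r
  1≤const (suc s) zero    = m^n>0 2 (suc E)
  1≤const (suc s) (suc k) = *-mono-≤ (*-mono-≤ (s≤s {n = 3} z≤n) (1≤const s (suc k))) (1≤const (suc s) k)

  bound-const : ∀ s k → s ≤ E → Bound s (suc k) (const s (suc k))
  contracted-const : ∀ s k → suc s ≤ E → ContractedBound (suc s) k (const (suc s) k)

  bound-const zero    k _ = bound-0 (suc k)
  bound-const (suc s) k l = bound-suc r E {s} {k} (1≤const s (suc k)) (1≤const (suc s) k)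
    (bound-const s k (<⇒≤ l)) (contracted-const s k l)

  contracted-const s zero    l = contracted-0 (suc s)
  contracted-const s (suc k) l = contracted-suc {suc s} {suc k} {const (suc s) (suc k)} l (bound-const (suc s) k l)

  -- The factor 4 turns the recursion into a plain product, so the exponents add, and `(2 + k) ^ s +
  -- suc k ^ suc s ≤ (2 + k) ^ suc s`.
  const-≤ : ∀ s k → 4 * const s k ≤ (r * 2 ^ (E + 3)) ^ (suc k ^ s)
  const-≤ zero k = begin
    4 * r                 ≡⟨ *-comm 4 r ⟩
    r * 2 ^ 2             ≤⟨ *-monoʳ-≤ r (^-monoʳ-≤ 2 (≤-trans (s≤s (s≤s z≤n)) (m≤n+m 3 E))) ⟩
    r * 2 ^ (E + 3)       ≡⟨ sym (*-identityʳ _) ⟩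
    (r * 2 ^ (E + 3)) ^ 1 ∎
    where open ≤-Reasoning
  const-≤ (suc s) zero = begin
    4 * 2 ^ suc E         ≡⟨ sym (^-distribˡ-+-* 2 2 (suc E)) ⟩
    2 ^ (2 + suc E)       ≡⟨ cong (2 ^_) (+-comm 3 E) ⟩
    2 ^ (E + 3)           ≤⟨ m≤n*m _ r ⟩
    r * 2 ^ (E + 3)       ≡⟨ sym (*-identityʳ _) ⟩
    (r * 2 ^ (E + 3)) ^ 1 ≡⟨ cong ((r * 2 ^ (E + 3)) ^_) (sym (^-zeroˡ (suc s))) ⟩
    (r * 2 ^ (E + 3)) ^ (1 ^ suc s) ∎
    where
    open ≤-Reasoning
    instance _ = >-nonZero 1≤r
  const-≤ (suc s) (suc k) = begin
    4 * (4 * const s (suc k) * const (suc s) k)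
      ≡⟨ regroup (const s (suc k)) (const (suc s) k) ⟩
    (4 * const s (suc k)) * (4 * const (suc s) k)
      ≤⟨ *-mono-≤ (const-≤ s (suc k)) (const-≤ (suc s) k) ⟩
    Y ^ ((2 + k) ^ s) * Y ^ (suc k ^ suc s)
      ≡⟨ sym (^-distribˡ-+-* Y ((2 + k) ^ s) (suc k ^ suc s)) ⟩
    Y ^ ((2 + k) ^ s + suc k ^ suc s)
      ≤⟨ ^-monoʳ-≤ Y (+-monoʳ-≤ ((2 + k) ^ s) (*-monoʳ-≤ (suc k) (^-monoˡ-≤ s (n≤1+n (suc k))))) ⟩
    Y ^ ((2 + k) ^ suc s) ∎
    where
    open ≤-Reasoning
    Y = r * 2 ^ (E + 3)
    instance _ = >-nonZero 1≤r
    instance _ = m^n≢0 2 (E + 3)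
    instance _ = m*n≢0 r (2 ^ (E + 3))
    regroup : ∀ a b → 4 * (4 * a * b) ≡ (4 * a) * (4 * b)
    regroup = solve-∀

-- The bound of `formation-free-≤` per letter when there are as many blocks as letters, with
-- `a = 2 + k`.
density : ℕ → ℕ → ℕ → ℕ
density r s a = (r * 2 ^ (s + 3)) ^ (a ^ s) * (1 + a ^ s)

-- `Ack (2 + k)` unfolds to `Fs (suc k) (2 + k)`, which dictates the level `suc k` and the choice
-- `j = 2 + k`; the exponent `E` is taken to be `s`.
formation-free-≤ : ∀ {A Blk : Set} {M : A → Blk → Set} (M? : B.Decidable M) X Y r s k →
  1 ≤ r → 1 ≤ s → ¬ Formation M r (suc s) X Y → length Y ≤ Ack (2 + k) →
  inc M? X Y ≤ (r * 2 ^ (s + 3)) ^ ((2 + k) ^ s) * (length X + (2 + k) ^ s * length Y)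
formation-free-≤ M? X Y r (suc s) k 1≤r _ ¬F l = begin
  inc M? X Y
    ≤⟨ bound-const r S 1≤r S k ≤-refl M? X Y (2 + k) ¬F
         (≤-trans l (≤-trans (≤-reflexive (sym (*-identityʳ _))) (^-monoʳ-≤ (Ack (2 + k)) (s≤s (z≤n {s}))))) ⟩
  const r S 1≤r S (suc k) * (length X + (2 + k) ^ S * length Y)
    ≤⟨ *-monoˡ-≤ _ (≤-trans (m≤n*m (const r S 1≤r S (suc k)) 4) (const-≤ r S 1≤r S (suc k))) ⟩
  (r * 2 ^ (S + 3)) ^ ((2 + k) ^ S) * (length X + (2 + k) ^ S * length Y) ∎
  where
  open ≤-Reasoning
  S = suc s
  instance _ = >-nonZero (Fs-suc-pos k (2 + k))

-- Counting cliques in hereditarily sparse graphs.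

ind-yes : {P : Set} (d : Dec P) → P → ind d ≡ 1
ind-yes (yes _) p = refl
ind-yes (no ¬p) p = contradiction p ¬p

ind-no : {P : Set} (d : Dec P) → ¬ P → ind d ≡ 0
ind-no (yes p) ¬p = contradiction p ¬p
ind-no (no _)  ¬p = refl

ind-⇔ : {P Q : Set} (d : Dec P) (e : Dec Q) → (P → Q) → (Q → P) → ind d ≡ ind e
ind-⇔ (yes p) e f g = sym (ind-yes e (f p))
ind-⇔ (no ¬p) e f g = sym (ind-no e (¬p ∘ g))

-- The geometric sum `1 + f + ... + f ^ (ℓ - 1)`.
cliqueRate : ℕ → ℕ → ℕ
cliqueRate f zero    = 0
cliqueRate f (suc ℓ) = 1 + f * cliqueRate f ℓ

_≟ₗ_ : B.DecidableEquality (List ℕ)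
_≟ₗ_ = ≡-dec _≟_

mult : List ℕ → List (List ℕ) → ℕ
mult π L = # (π ≟ₗ_) L

module _ {M : ℕ → ℕ → Set} (M? : B.Decidable M) where

  succs : List ℕ → ℕ → List ℕ
  succs S v = filter (M? v) S

  module Cliques (U : List ℕ) (f : ℕ)
    (sparse : ∀ {S} → S ⊆ U → ∑ (λ v → length (succs S v)) S ≤ f * length S) where

    link : ℕ → List (List ℕ) → List (List ℕ)
    link v []            = []
    link v ([] ∷ L)      = link v L
    link v ((x ∷ π) ∷ L) with v ≟ x
    ... | yes _ = π ∷ link v L
    ... | no _  = link v L

    record Clique (ℓ : ℕ) (S π : List ℕ) : Set where
      constructor clique
      field
        short    : length π ≤ ℓ
        vertices : All (_∈ S) π
        adjacent : AllPairs M π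

    open Clique

    mult-link-∷ : ∀ v π x ρ L →
      mult π (link v ((x ∷ ρ) ∷ L)) ≡ ind ((v ∷ π) ≟ₗ (x ∷ ρ)) + mult π (link v L)
    mult-link-∷ v π x ρ L with v ≟ x
    ... | no _     = refl
    ... | yes refl = trans (#-∷ (π ≟ₗ_) ρ (link v L))
      (cong (_+ mult π (link v L)) (ind-⇔ (π ≟ₗ ρ) _ (cong (v ∷_)) ∷-injectiveʳ))

    -- Prefixing `v` is injective, so a bound `μ` on multiplicities is inherited by every link.
    mult-link : ∀ v π L → mult π (link v L) ≡ mult (v ∷ π) L
    mult-link v π []            = refl
    mult-link v π ([] ∷ L)      = trans (mult-link v π L) (sym (#-∷ ((v ∷ π) ≟ₗ_) [] L))
    mult-link v π ((x ∷ ρ) ∷ L) = trans (mult-link-∷ v π x ρ L)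
      (trans (cong (ind ((v ∷ π) ≟ₗ (x ∷ ρ)) +_) (mult-link v π L)) (sym (#-∷ ((v ∷ π) ≟ₗ_) (x ∷ ρ) L)))

    length-link-∷ : ∀ v x ρ L → length (link v ((x ∷ ρ) ∷ L)) ≡ ind (v ≟ x) + length (link v L)
    length-link-∷ v x ρ L with v ≟ x
    ... | yes _ = refl
    ... | no _  = refl

    -- A nonempty clique is counted in the link of its first vertex, which lies in `S`; as `S` may
    -- repeat vertices, this is only an inequality.
    length-link : ∀ S L → All (All (_∈ S)) L → length L ≤ mult [] L + ∑ (λ v → length (link v L)) S
    length-link S []            _ = z≤n
    length-link S ([] ∷ L)      (_ ∷ ps) = s≤s (length-link S L ps)
    length-link S ((x ∷ ρ) ∷ L) ((p ∷ _) ∷ ps) = begin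
      1 + length L
        ≤⟨ +-mono-≤ (counted p) (length-link S L ps) ⟩
      ∑ (λ v → ind (v ≟ x)) S + (mult [] L + ∑ (λ v → length (link v L)) S)
        ≡⟨ swap (∑ (λ v → ind (v ≟ x)) S) (mult [] L) _ ⟩
      mult [] L + (∑ (λ v → ind (v ≟ x)) S + ∑ (λ v → length (link v L)) S)
        ≡⟨ cong (mult [] L +_) (sym (trans (∑-cong S (λ v → length-link-∷ v x ρ L)) (∑-+ _ _ S))) ⟩
      mult [] L + ∑ (λ v → length (link v ((x ∷ ρ) ∷ L))) S ∎
      where
      open ≤-Reasoning
      swap : ∀ a b c → a + (b + c) ≡ b + (a + c)
      swap = solve-∀
      counted : ∀ {S} → x ∈ S → 1 ≤ ∑ (λ v → ind (v ≟ x)) S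
      counted (here refl) = ≤-trans (≤-reflexive (sym (ind-yes (x ≟ x) refl))) (m≤m+n _ _)
      counted (there q)   = ≤-trans (counted q) (m≤n+m _ _)

    link-clique : ∀ {ℓ S} v L → All (Clique (suc ℓ) S) L → All (Clique ℓ (succs S v)) (link v L)
    link-clique v []            []       = []
    link-clique v ([] ∷ L)      (_ ∷ cs) = link-clique v L cs
    link-clique v ((x ∷ π) ∷ L) (clique (s≤s l) (_ ∷ vs) (a ∷ as) ∷ cs) with v ≟ x
    ... | no _     = link-clique v L cs
    ... | yes refl = clique l (All.zipWith (λ (p , q) → ∈-filter⁺ (M? v) p q) (vs , a)) as ∷ link-clique v L cs

    -- Induction on `ℓ`, sorting cliques by first vertex. Those starting at `v` continue inside
    -- `succs S v`, and these sets have total size at most `f * length S`. Since the induction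
    -- passes to `succs S v`, sparseness is assumed for all sublists of `U`.
    length-cliques : ∀ ℓ μ S L → S ⊆ U → All (Clique ℓ S) L → (∀ π → mult π L ≤ μ) →
      length L ≤ μ * (1 + length S * cliqueRate f ℓ)
    length-cliques zero    μ S L τ cs m = begin
      length L                  ≤⟨ all-empty L cs ⟩
      mult [] L                 ≤⟨ m [] ⟩
      μ                         ≡⟨ sym (*-identityʳ μ) ⟩
      μ * 1                     ≡⟨ cong (λ z → μ * (1 + z)) (sym (*-zeroʳ (length S))) ⟩
      μ * (1 + length S * 0)    ∎
      where
      open ≤-Reasoning
      all-empty : ∀ L → All (Clique 0 S) L → length L ≤ mult [] L
      all-empty []       []                 = z≤n
      all-empty ([] ∷ L) (_ ∷ cs)           = s≤s (all-empty L cs)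
      all-empty ((_ ∷ _) ∷ L) (clique () _ _ ∷ _)
    length-cliques (suc ℓ) μ S L τ cs m = begin
      length L
        ≤⟨ length-link S L (All.map vertices cs) ⟩
      mult [] L + ∑ (λ v → length (link v L)) S
        ≤⟨ +-mono-≤ (m []) (∑-mono _ _ S λ _ v _ _ →
             length-cliques ℓ μ (succs S v) (link v L) (⊆-trans (filter-⊆ (M? v) S) τ) (link-clique v L cs)
               (λ π → ≤-trans (≤-reflexive (mult-link v π L)) (m (v ∷ π)))) ⟩
      μ + ∑ (λ v → μ * (1 + length (succs S v) * cliqueRate f ℓ)) S
        ≡⟨ cong (μ +_) (trans (∑-* μ _ S) (cong (μ *_) (trans (∑-+ _ _ S) (cong₂ _+_ (∑-1 S)
             (trans (∑-cong S (λ v → *-comm (length (succs S v)) (cliqueRate f ℓ))) (∑-* (cliqueRate f ℓ) _ S)))))) ⟩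
      μ + μ * (length S + cliqueRate f ℓ * ∑ (λ v → length (succs S v)) S)
        ≤⟨ +-monoʳ-≤ μ (*-monoʳ-≤ μ (+-monoʳ-≤ (length S) (*-monoʳ-≤ (cliqueRate f ℓ) (sparse τ)))) ⟩
      μ + μ * (length S + cliqueRate f ℓ * (f * length S))
        ≡⟨ factor μ (length S) (cliqueRate f ℓ) f ⟩
      μ * (1 + length S * (1 + f * cliqueRate f ℓ)) ∎
      where
      open ≤-Reasoning
      factor : ∀ μ n g f → μ + μ * (n + g * (f * n)) ≡ μ * (1 + n * (1 + f * g))
      factor = solve-∀

-- Sorted lists and order-preserving tables.

AllPairs-++⁻ : {A : Set} {R : A → A → Set} (xs : List A) {ys : List A} → AllPairs R (xs ++ ys) →
  AllPairs R xs × AllPairs R ys × All (λ x → All (R x) ys) xs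
AllPairs-++⁻ []       ps       = [] , ps , []
AllPairs-++⁻ (x ∷ xs) (p ∷ ps) with AllPairs-++⁻ xs ps
... | l , r , c = All.++⁻ˡ xs p ∷ l , r , All.++⁻ʳ xs p ∷ c

AllPairs-resp-⊆ : {A : Set} {R : A → A → Set} {xs ys : List A} → xs ⊆ ys → AllPairs R ys → AllPairs R xs
AllPairs-resp-⊆ []         []       = []
AllPairs-resp-⊆ (_ ∷ʳ τ)   (_ ∷ ps) = AllPairs-resp-⊆ τ ps
AllPairs-resp-⊆ (refl ∷ τ) (p ∷ ps) = All-resp-⊆ τ p ∷ AllPairs-resp-⊆ τ ps

∈-resp-⊆ : {A : Set} {x : A} {xs ys : List A} → xs ⊆ ys → x ∈ xs → x ∈ ys
∈-resp-⊆ = Any-resp-⊆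

Linked⇒AllPairs-< : ∀ {xs} → Linked _<_ xs → AllPairs _<_ xs
Linked⇒AllPairs-< = Linked.Linked⇒AllPairs <-trans

-- Sends the `i`-th key to the `i`-th value; 0 is a dummy value for arguments without an entry.
assoc : List ℕ → List ℕ → ℕ → ℕ
assoc (k ∷ K) (v ∷ V) u with u ≟ k
... | yes _ = v
... | no _  = assoc K V u
assoc _ _ _ = 0

assoc-∈ : ∀ K V {u} → length K ≡ length V → u ∈ K → assoc K V u ∈ V
assoc-∈ (k ∷ K) (v ∷ V) {u} l u∈ with u ≟ k
assoc-∈ (k ∷ K) (v ∷ V) l u∈         | yes _ = here refl
assoc-∈ (k ∷ K) (v ∷ V) l (here eq)  | no ¬p = contradiction eq ¬p
assoc-∈ (k ∷ K) (v ∷ V) l (there u∈) | no _  = there (assoc-∈ K V (suc-injective l) u∈)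

assoc-mono-< : ∀ K V → AllPairs _<_ K → AllPairs _<_ V → length K ≡ length V →
  ∀ {u w} → u ∈ K → w ∈ K → u < w → assoc K V u < assoc K V w
assoc-mono-< (k ∷ K) (v ∷ V) (pk ∷ pK) (pv ∷ pV) l {u} {w} u∈ w∈ u<w with u ≟ k | w ≟ k
... | yes refl | yes refl = contradiction u<w (<-irrefl refl)
assoc-mono-< (k ∷ K) (v ∷ V) (pk ∷ pK) (pv ∷ pV) l u∈ (here eq) u<w | yes _ | no ¬q = contradiction eq ¬q
assoc-mono-< (k ∷ K) (v ∷ V) (pk ∷ pK) (pv ∷ pV) l u∈ (there w∈) u<w | yes _ | no _ =
  All.lookup pv (assoc-∈ K V (suc-injective l) w∈)
assoc-mono-< (k ∷ K) (v ∷ V) (pk ∷ pK) (pv ∷ pV) l (here eq) w∈ u<w | no ¬p | _ = contradiction eq ¬p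
assoc-mono-< (k ∷ K) (v ∷ V) (pk ∷ pK) (pv ∷ pV) l (there u∈) w∈ u<w | no _ | yes refl =
  contradiction (<-trans u<w (All.lookup pk u∈)) (<-irrefl refl)
assoc-mono-< (k ∷ K) (v ∷ V) (pk ∷ pK) (pv ∷ pV) l (there u∈) (here eq) u<w | no _ | no ¬q = contradiction eq ¬q
assoc-mono-< (k ∷ K) (v ∷ V) (pk ∷ pK) (pv ∷ pV) l (there u∈) (there w∈) u<w | no _ | no _ =
  assoc-mono-< K V pK pV (suc-injective l) u∈ w∈ u<w

assoc-≡ : ∀ k K v V → assoc (k ∷ K) (v ∷ V) k ≡ v
assoc-≡ k K v V with k ≟ k
... | yes _ = refl
... | no ¬p = contradiction refl ¬p

assoc-≢ : ∀ {k u} K v V → k < u → assoc (k ∷ K) (v ∷ V) u ≡ assoc K V u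
assoc-≢ {k} {u} K v V k<u with u ≟ k
... | yes refl = contradiction k<u (<-irrefl refl)
... | no _     = refl

-- Embedding a star forest.

module _ (F : StarForest) (H : List (List ℕ)) where
  open StarForest F renaming (A to centres; B to leaves)

  -- The image of a leaf, paired with the index of the edge that is to join it to the image of its
  -- centre.
  Pick : Set
  Pick = ℕ × Fin (length H)

  Covers : ℕ → Pick → Set
  Covers x (y , i) = x ∈ lookup H i × y ∈ lookup H i

  -- t rounds always offer an edge at a given letter outside the fewer than q edges used so far.
  Selectable : (ℕ → ℕ → Set) → ℕ → Set
  Selectable M t = ∀ x ys ps → length ys ≡ t → AllPairs _<_ ys → All (M x) ys → length ps < q →
    All (λ (y′ , i) → y′ ∈ lookup H i × x < y′ × All (y′ <_) ys) ps →
    Σ Pick λ p → proj₁ p ∈ ys × Covers x p × All (λ p′ → proj₂ p ≢ proj₂ p′) ps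

  module _ (xs : List ℕ) where

    Chosen : List ℕ → List Pick → Set
    Chosen = Pointwise (λ b → Covers (assoc centres xs (centre b)))

    module _ (#xs : length centres ≡ length xs) (xs-sorted : AllPairs _<_ xs)
             {ps : List Pick} (chosen : Chosen leaves ps)
             (ps-sorted : AllPairs _<_ (map proj₁ ps))
             (xs<ps : All (λ x → All (x <_) (map proj₁ ps)) xs)
             (distinct : AllPairs _≢_ (map proj₂ ps)) where

      private
        ys = map proj₁ ps

        #ys : length leaves ≡ length ys
        #ys = trans (Pointwise-length chosen) (sym (length-map proj₁ ps))

        φ : ℕ → ℕ
        φ u with u ∈? centres
        ... | yes _ = assoc centres xs u
        ... | no _  = assoc leaves ys u

        φ-centre : ∀ {a} → a ∈ centres → φ a ≡ assoc centres xs a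
        φ-centre {a} a∈ with a ∈? centres
        ... | yes _ = refl
        ... | no ¬a = contradiction a∈ ¬a

        φ-leaf : ∀ {b} → b ∈ leaves → φ b ≡ assoc leaves ys b
        φ-leaf {b} b∈ with b ∈? centres
        ... | yes a = contradiction (A<B b b a b∈) (<-irrefl refl)
        ... | no _  = refl

        vertex : ∀ u → InU u edges → u ∈ centres ⊎ u ∈ leaves
        vertex u u∈ with find (Any.map⁻ u∈)
        ... | b , b∈ , here refl         = inj₁ (centre∈A b b∈)
        ... | b , b∈ , there (here refl) = inj₂ b∈

        increasing : ∀ {u w} → u ∈ centres ⊎ u ∈ leaves → w ∈ centres ⊎ w ∈ leaves → u < w → φ u < φ w
        increasing (inj₁ u∈) (inj₁ w∈) u<w rewrite φ-centre u∈ | φ-centre w∈ =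
          assoc-mono-< centres xs (Linked⇒AllPairs-< A-sorted) xs-sorted #xs u∈ w∈ u<w
        increasing (inj₁ u∈) (inj₂ w∈) u<w rewrite φ-centre u∈ | φ-leaf w∈ =
          All.lookup (All.lookup xs<ps (assoc-∈ centres xs #xs u∈)) (assoc-∈ leaves ys #ys w∈)
        increasing (inj₂ u∈) (inj₁ w∈) u<w = contradiction (<-trans u<w (A<B _ _ w∈ u∈)) (<-irrefl refl)
        increasing (inj₂ u∈) (inj₂ w∈) u<w rewrite φ-leaf u∈ | φ-leaf w∈ =
          assoc-mono-< leaves ys (Linked⇒AllPairs-< B-sorted) ps-sorted #ys u∈ w∈ u<w

        edge : ℕ → List ℕ
        edge b = centre b ∷ b ∷ []

        f : ∀ {bs qs} → Chosen bs qs → Fin (length (map edge bs)) → Fin (length H)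
        f {qs = (_ , i) ∷ _} (_ ∷ c) zero    = i
        f                    (_ ∷ c) (suc j) = f c j

        f-∈ : ∀ {bs qs} (c : Chosen bs qs) j → f c j ∈ map proj₂ qs
        f-∈ (_ ∷ c) zero    = here refl
        f-∈ (_ ∷ c) (suc j) = there (f-∈ c j)

        f-injective : ∀ {bs qs} (c : Chosen bs qs) → AllPairs _≢_ (map proj₂ qs) → Injective _≡_ _≡_ (f c)
        f-injective (_ ∷ c) (d ∷ ds) {zero}  {zero}  eq = refl
        f-injective (_ ∷ c) (d ∷ ds) {zero}  {suc j} eq = contradiction eq (All.lookup d (f-∈ c j))
        f-injective (_ ∷ c) (d ∷ ds) {suc i} {zero}  eq = contradiction (sym eq) (All.lookup d (f-∈ c i))
        f-injective (_ ∷ c) (d ∷ ds) {suc i} {suc j} eq = cong suc (f-injective c ds eq)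

        -- Along the induction, agreement of `φ` with the whole table of leaves becomes agreement
        -- with the table of the remaining ones; the removed leaves are smaller, so `assoc-≢`
        -- applies.
        f-covers : ∀ {bs qs} (c : Chosen bs qs) → AllPairs _<_ bs → All (_∈ leaves) bs →
          (∀ {b} → b ∈ bs → φ b ≡ assoc bs (map proj₁ qs) b) →
          ∀ j v → v ∈ lookup (map edge bs) j → φ v ∈ lookup H (f c j)
        f-covers {b ∷ bs} {(y , i) ∷ qs} ((p , q) ∷ c) _ (b∈ ∷ _) e zero v (here refl) =
          subst (_∈ lookup H i) (sym (φ-centre (centre∈A b b∈))) p
        f-covers {b ∷ bs} {(y , i) ∷ qs} ((p , q) ∷ c) _ _ e zero v (there (here refl)) =
          subst (_∈ lookup H i) (sym (trans (e (here refl)) (assoc-≡ b bs y (map proj₁ qs)))) q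
        f-covers {b ∷ bs} {(y , i) ∷ qs} (_ ∷ c) (b< ∷ s) (_ ∷ ls) e (suc j) v v∈ = f-covers c s ls
          (λ b∈ → trans (e (there b∈)) (assoc-≢ bs y (map proj₁ qs) (All.lookup b< b∈))) j v v∈

        covers : ∀ j v → v ∈ lookup edges j → φ v ∈ lookup H (f chosen j)
        covers = f-covers chosen (Linked⇒AllPairs-< B-sorted) (All.tabulate id) φ-leaf

      -- Centres and leaves are mapped by separate tables, which cannot conflict because no number
      -- is both. Across the tables order is kept since every letter of `xs` precedes every picked
      -- vertex, and distinct indices make the edge map injective.
      chosen⇒≻ : H ≻ edges
      chosen⇒≻ = φ
        , (λ u w u∈ w∈ → increasing (vertex u u∈) (vertex w w∈))
        , (λ u u∈ → lose (∈-lookup {xs = H} (f chosen (Any.index u∈))) (covers (Any.index u∈) u (Any.lookup-index u∈)))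
        , f chosen , f-injective chosen distinct , covers

    module _ {M : ℕ → ℕ → Set} where

      takeRounds : ∀ {s} t {Y} → Rounds M xs (t + s) Y →
        ∃₂ λ Y₁ Y₂ → Y ≡ Y₁ ++ Y₂ × Rounds M xs t Y₁ × Rounds M xs s Y₂
      takeRounds zero    R = [] , _ , refl , done , R
      takeRounds (suc t) (more Y₁ Y₂ p R) with takeRounds t R
      ... | Z₁ , Z₂ , refl , R₁ , R₂ = Y₁ ++ Z₁ , Z₂ , sym (++-assoc Y₁ Z₁ Z₂) , more Y₁ Z₁ p R₁ , R₂

      neighbours : ∀ {x t Y} → x ∈ xs → Rounds M xs t Y →
        Σ (List ℕ) λ ys → ys ⊆ Y × length ys ≡ t × All (M x) ys
      neighbours {Y = Y} x∈ done = [] , minimum Y , refl , []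
      neighbours x∈ (more Y₁ Y₂ p R) with find (All.lookup p x∈) | neighbours x∈ R
      ... | y , y∈ , m | ys , τ , l , ms = y ∷ ys , ++⁺ (from∈ y∈) τ , cong suc l , m ∷ ms

      module _ {t : ℕ} (select : Selectable M t) (#xs : length centres ≡ length xs) where

        greedy : ∀ bs Y ps → All (_∈ centres) (map centre bs) → AllPairs _<_ Y →
          Rounds M xs (length bs * t) Y →
          All (λ x → All (x <_) Y) xs →
          All (λ (y , i) → y ∈ lookup H i × All (_< y) xs × All (y <_) Y) ps →
          length ps + length bs ≤ q →
          Σ (List Pick) λ qs → Chosen bs qs × AllPairs _<_ (map proj₁ qs) × All (_∈ Y) (map proj₁ qs) ×
            All (λ i → All (λ p → i ≢ proj₂ p) ps) (map proj₂ qs) × AllPairs _≢_ (map proj₂ qs)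
        greedy []       Y ps cs sY R xs<Y used l = [] , [] , [] , [] , [] , []
        greedy (b ∷ bs) Y ps (c∈ ∷ cs) sY R xs<Y used l with takeRounds t R
        ... | Y₁ , Y₂ , refl , R₁ , R₂ with AllPairs-++⁻ Y₁ sY | neighbours (assoc-∈ centres xs #xs c∈) R₁
        ... | s₁ , s₂ , Y₁<Y₂ | ys , τ , lys , ms
          with select (assoc centres xs (centre b)) ys ps lys (AllPairs-resp-⊆ τ s₁) ms
                 (≤-trans (≤-reflexive (+-comm 1 (length ps))) (≤-trans (+-monoʳ-≤ (length ps) (s≤s (z≤n {length bs}))) l))
                 (All.map (λ (y∈ , xs<y , y<Y) → y∈ , All.lookup xs<y (assoc-∈ centres xs #xs c∈) , All-resp-⊆ τ (All.++⁻ˡ Y₁ y<Y)) used)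
        ... | (y , i) , y∈ys , cov , fresh
          with ∈-resp-⊆ τ y∈ys
        ... | y∈Y₁
          with greedy bs Y₂ ((y , i) ∷ ps) cs s₂ R₂ (All.map (All.++⁻ʳ Y₁) xs<Y)
                 ((proj₂ cov , All.map (λ x< → All.lookup (All.++⁻ˡ Y₁ x<) y∈Y₁) xs<Y , All.lookup Y₁<Y₂ y∈Y₁)
                   ∷ All.map (λ (y∈ , xs<y , y<Y) → y∈ , xs<y , All.++⁻ʳ Y₁ y<Y) used)
                 (≤-trans (≤-reflexive (sym (+-suc (length ps) (length bs)))) l)
        ... | qs , ch , sqs , qs∈ , fr , di =
          (y , i) ∷ qs , cov ∷ ch
          , All.map (All.lookup (All.lookup Y₁<Y₂ y∈Y₁)) qs∈ ∷ sqs
          , Any.++⁺ˡ y∈Y₁ ∷ All.map (Any.++⁺ʳ Y₁) qs∈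
          , fresh ∷ All.map All.tail fr
          , All.map (λ f e → All.head f (sym e)) fr ∷ di

  -- The first round only secures the order: each letter has a larger neighbour in it, so all
  -- letters lie below the blocks of the other `q * t` rounds, which supply `t` rounds for each
  -- leaf.
  formation⇒≻ : ∀ {M : ℕ → ℕ → Set} {t S} → (∀ {x y} → M x y → x < y) → AllPairs _<_ S →
    Selectable M t → Formation M r (suc (q * t)) S S → H ≻ edges
  formation⇒≻ {M} {t} {S} M⇒< sS select (xs , τ , #xs , R) = build R refl
    where
    build : ∀ {Y} → Rounds M xs (suc (q * t)) Y → Y ≡ S → H ≻ edges
    build (more Y₁ Y₂ p R′) refl with AllPairs-++⁻ Y₁ sS
    ... | s₁ , s₂ , Y₁<Y₂
      with All.map (λ x-occurs → let (y , y∈ , m) = find x-occurs in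
             All.map (<-trans (M⇒< m)) (All.lookup Y₁<Y₂ y∈)) p
    ... | xs<Y₂
      with greedy xs select (sym #xs) leaves Y₂ [] (All.map⁺ (All.tabulate (centre∈A _))) s₂ R′ xs<Y₂ [] ≤-refl
    ... | qs , ch , sqs , qs∈ , _ , di =
      chosen⇒≻ xs (sym #xs) (AllPairs-resp-⊆ τ sS) ch sqs
        (All.map (λ x< → All.map (All.lookup x<) qs∈) xs<Y₂) di

  -- Every listed edge contains all of `π`, so any matching works: the first `r` vertices become
  -- centres, the rest leaves, and the edges are assigned to leaves in list order.
  common-vertices⇒≻ : ∀ π → AllPairs _<_ π → length π ≡ p →
    ∀ is → AllPairs _≢_ is → length is ≡ q → All (λ i → All (_∈ lookup H i) π) is → H ≻ edges
  common-vertices⇒≻ π sπ #π is di #is cov with AllPairs-++⁻ (take r π) (subst (AllPairs _<_) (sym (take++drop≡id r π)) sπ)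
  ... | s₁ , s₂ , lt = chosen⇒≻ xs #xs s₁
    (chosen leaves ys is (sym #ys) (sym #is) (All.tabulate (centre∈A _)) (All.map (All.++⁻ʳ xs) cov′) (All.map (All.++⁻ˡ xs) cov′))
    (subst (AllPairs _<_) (sym (map-proj₁-zip ys is #zip)) s₂)
    (subst (λ ys → All (λ x → All (x <_) ys) xs) (sym (map-proj₁-zip ys is #zip)) lt)
    (subst (AllPairs _≢_) (sym (map-proj₂-zip ys is #zip)) di)
    where
    xs = take r π
    ys = drop r π
    #xs : length centres ≡ length xs
    #xs = sym (trans (length-take r π) (m≤n⇒m⊓n≡m (≤-trans (m≤m+n r q) (≤-reflexive (sym #π)))))
    #ys : length ys ≡ q
    #ys = trans (length-drop r π) (trans (cong (_∸ r) #π) (m+n∸m≡n r q))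
    #zip : length ys ≡ length is
    #zip = trans #ys (sym #is)
    cov′ : All (λ i → All (_∈ lookup H i) (xs ++ ys)) is
    cov′ = All.map (λ {i} → subst (All (_∈ lookup H i)) (sym (take++drop≡id r π))) cov
    map-proj₁-zip : ∀ (ys : List ℕ) (is : List (Fin (length H))) → length ys ≡ length is → map proj₁ (zip ys is) ≡ ys
    map-proj₁-zip []       []       _ = refl
    map-proj₁-zip (y ∷ ys) (i ∷ is) l = cong (y ∷_) (map-proj₁-zip ys is (suc-injective l))
    map-proj₂-zip : ∀ (ys : List ℕ) (is : List (Fin (length H))) → length ys ≡ length is → map proj₂ (zip ys is) ≡ is
    map-proj₂-zip []       []       _ = refl
    map-proj₂-zip (y ∷ ys) (i ∷ is) l = cong (i ∷_) (map-proj₂-zip ys is (suc-injective l))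
    chosen : ∀ bs ys is → length bs ≡ length ys → length bs ≡ length is → All (λ b → centre b ∈ centres) bs →
      All (λ i → All (_∈ lookup H i) ys) is → All (λ i → All (_∈ lookup H i) xs) is →
      Chosen xs bs (zip ys is)
    chosen []       []       []       _ _ _ _ _ = []
    chosen (b ∷ bs) (y ∷ ys) (i ∷ is) l l′ (c∈ ∷ cs) ((y∈ ∷ _) ∷ covy) (xs⊆ ∷ covx) =
      (All.lookup xs⊆ (assoc-∈ centres xs #xs c∈) , y∈)
        ∷ chosen bs ys is (suc-injective l) (suc-injective l′) cs (All.map All.tail covy) covx

-- Vertex sets and the shadow graph.

<⇒distinct : ∀ {xs} → AllPairs _<_ xs → AllPairs _≢_ xs
<⇒distinct = AllPairs.map <⇒≢

distinct⇒length-≤ : {A : Set} {xs ys : List A} → AllPairs _≢_ xs → (∀ {x} → x ∈ xs → x ∈ ys) → length xs ≤ length ys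
distinct⇒length-≤ []       s = z≤n
distinct⇒length-≤ {xs = x ∷ xs} (d ∷ ds) s with ∈-∃++ (s (here refl))
... | ys , zs , refl = begin
  suc (length xs)           ≤⟨ s≤s (distinct⇒length-≤ ds avoid) ⟩
  suc (length (ys ++ zs))   ≡⟨ sym (length-++-sucʳ ys x zs) ⟩
  length (ys ++ x ∷ zs)     ∎
  where
  open ≤-Reasoning
  avoid : ∀ {y} → y ∈ xs → y ∈ ys ++ zs
  avoid y∈ with ∈-++⁻ ys (s (there y∈))
  ... | inj₁ y∈ys         = ∈-++⁺ˡ y∈ys
  ... | inj₂ (here refl)  = contradiction refl (All.lookup d y∈)
  ... | inj₂ (there y∈zs) = ∈-++⁺ʳ ys y∈zs

#-distinct : {A : Set} {P : A → Set} (P? : Decidable P) {xs : List A} → AllPairs _≢_ xs →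
  (∀ {x y} → P x → P y → x ≡ y) → # P? xs ≤ 1
#-distinct P? {xs} d unique = go (filter P? xs) (AllPairs.filter⁺ P? d) (All.all-filter P? xs)
  where
  go : ∀ ys → AllPairs _≢_ ys → All _ ys → length ys ≤ 1
  go []           _             _             = z≤n
  go (_ ∷ [])     _             _             = s≤s z≤n
  go (_ ∷ _ ∷ _) ((x≢y ∷ _) ∷ _) (px ∷ py ∷ _) = contradiction (unique px py) x≢y

-- Enumerated in increasing order, because the vertices are read as a sequence of blocks.
vertices : List (List ℕ) → List ℕ
vertices H = filter (_∈? concat H) (upTo (suc (max 0 (concat H))))

vertices-sorted : ∀ H → AllPairs _<_ (vertices H)
vertices-sorted H = AllPairs.filter⁺ (_∈? concat H) (AllPairs.applyUpTo⁺₁ id _ (λ i<j _ → i<j))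

length-vertices : ∀ H → length (vertices H) ≤ vH H
length-vertices H = distinct⇒length-≤ (<⇒distinct (vertices-sorted H))
  λ v∈ → ∈-deduplicate⁺ _≟_ (proj₂ (∈-filter⁻ (_∈? concat H) {xs = upTo _} v∈))

∈-vertices : ∀ {H E v} → v ∈ E → E ∈ H → v ∈ vertices H
∈-vertices {H} v∈ E∈ = ∈-filter⁺ (_∈? concat H) (∈-upTo⁺ (s≤s (All.lookup (xs≤max 0 (concat H)) v∈H))) v∈H
  where v∈H = ∈-concat⁺′ v∈ E∈

module Pieces (H : List (List ℕ)) (pieces : List ℕ → List (List ℕ)) where

  Together : ℕ → ℕ → List ℕ → Set
  Together x y E = Any (λ π → x ∈ π × y ∈ π) (pieces E)

  -- A common piece is required, not just a common edge: when pieces are short and disjoint, one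
  -- edge gives a vertex only boundedly many neighbours.
  Adj : ℕ → ℕ → Set
  Adj x y = x < y × Any (Together x y) H

  adj? : B.Decidable Adj
  adj? x y = (x <? y) ×-dec any? (λ E → any? (λ π → (x ∈? π) ×-dec (y ∈? π)) (pieces E)) H

  record Pieces⊆Edges : Set where
    field
      piece-sorted : ∀ {E π} → E ∈ H → π ∈ pieces E → AllPairs _<_ π
      piece-⊆      : ∀ {E π v} → E ∈ H → π ∈ pieces E → v ∈ π → v ∈ E

  module _ (wf : Pieces⊆Edges) where
    open Pieces⊆Edges wf

    adj-edge : ∀ {x y} → Adj x y → Σ (Fin (length H)) λ i →
      Together x y (lookup H i) × x ∈ lookup H i × y ∈ lookup H i
    adj-edge (_ , tog) with Any.lookup-index tog
    ... | t with find t
    ... | π , π∈ , x∈ , y∈ = Any.index tog , t , piece-⊆ E∈ π∈ x∈ , piece-⊆ E∈ π∈ y∈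
      where E∈ = ∈-lookup {xs = H} (Any.index tog)

    module _ {f ℓ μ : ℕ}
      (sparse : ∀ {S} → S ⊆ vertices H → inc adj? S S ≤ f * length S)
      (short : ∀ {E π} → E ∈ H → π ∈ pieces E → length π ≤ ℓ) where

      open Cliques adj? (vertices H) f
        (λ {S} τ → ≤-trans (≤-reflexive (sym (inc-transpose adj? S S))) (sparse τ)) public

      pieces-cliques : All (Clique ℓ (vertices H)) (concatMap pieces H)
      pieces-cliques = All.tabulate λ {π} π∈ → let (E , E∈ , π∈E) = find (∈-concatMap⁻ pieces π∈) in
        clique (short E∈ π∈E) (All.tabulate (λ v∈ → ∈-vertices (piece-⊆ E∈ π∈E v∈) E∈))
          (pairs E∈ π∈E π (piece-sorted E∈ π∈E) id)
        where
        pairs : ∀ {E π} → E ∈ H → π ∈ pieces E → ∀ ρ → AllPairs _<_ ρ → (∀ {v} → v ∈ ρ → v ∈ π) → AllPairs Adj ρ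
        pairs E∈ π∈ []      []       s = []
        pairs E∈ π∈ (x ∷ ρ) (p ∷ ps) s =
          All.tabulate (λ y∈ → All.lookup p y∈ , lose E∈ (lose π∈ (s (here refl) , s (there y∈))))
            ∷ pairs E∈ π∈ ρ ps (s ∘ there)

      length-pieces : (∀ π → mult π (concatMap pieces H) ≤ μ) →
        length (concatMap pieces H) ≤ μ * (1 + length (vertices H) * cliqueRate f ℓ)
      length-pieces = length-cliques ℓ μ (vertices H) _ ⊆-refl pieces-cliques

  sparse-≤ : ∀ {S m} → length S ≤ m → inc adj? S S ≤ m * length S
  sparse-≤ {S} l = ≤-trans (inc-≤-* adj? S S) (*-monoˡ-≤ (length S) l)

  module _ (F : StarForest) (¬H≻F : ¬ (H ≻ StarForest.edges F)) where
    open StarForest F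

    -- `S` provides both the letters and the blocks, the block `y` consisting of the lower
    -- neighbours of `y` in `S`. Too many adjacencies would force a formation with `suc (q * t)`
    -- rounds, hence a copy of the forest.
    sparse-density : ∀ {t k n S} → 1 ≤ r → 1 ≤ q * t → Selectable F H Adj t → vH H ≤ n → n ≤ Ack (2 + k) →
      S ⊆ vertices H → inc adj? S S ≤ density r (q * t) (2 + k) * length S
    sparse-density {t} {k} {n} {S} 1≤r 1≤s select v≤n n≤A τ = begin
      inc adj? S S
        ≤⟨ formation-free-≤ adj? S S r s k 1≤r 1≤s
             (¬H≻F ∘ formation⇒≻ F H {M = Adj} proj₁ (AllPairs-resp-⊆ τ (vertices-sorted H)) select)
             (≤-trans (length-mono-≤ τ) (≤-trans (length-vertices H) (≤-trans v≤n n≤A))) ⟩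
      P * (length S + W * length S)    ≡⟨ cong (P *_) (cong (_+ W * length S) (sym (*-identityˡ (length S)))) ⟩
      P * (1 * length S + W * length S) ≡⟨ cong (P *_) (sym (*-distribʳ-+ (length S) 1 W)) ⟩
      P * ((1 + W) * length S)         ≡⟨ sym (*-assoc P (1 + W) (length S)) ⟩
      density r s (2 + k) * length S   ∎
      where
      open ≤-Reasoning
      s = q * t
      W = (2 + k) ^ s
      P = (r * 2 ^ (s + 3)) ^ W

hypergraph-sorted : ∀ {H E} → Hypergraph H → E ∈ H → AllPairs _<_ E
hypergraph-sorted hyp E∈ = Linked⇒AllPairs-< (proj₁ (All.lookup hyp E∈))

-- `edges` is then a single pair, so only two vertices need images: the leaf goes to `y` and
-- everything else to `x`.
single-edge⇒≻ : (F : StarForest) (H : List (List ℕ)) → StarForest.q F ≡ 1 → ∀ {x y} → x < y →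
  (i : Fin (length H)) → x ∈ lookup H i → y ∈ lookup H i → H ≻ StarForest.edges F
single-edge⇒≻ F H q≡1 {x} {y} x<y i x∈ y∈ =
  go leaves q≡1 (λ {b} b∈ → A<B (centre b) b (centre∈A b b∈) b∈)
  where
  open StarForest F renaming (B to leaves)
  go : ∀ bs → length bs ≡ 1 → (∀ {b} → b ∈ bs → centre b < b) → H ≻ map (λ b → centre b ∷ b ∷ []) bs
  go (b ∷ []) _ c<b = φ , increasing , (λ u u∈ → lose (∈-lookup {xs = H} i) (φ∈ u)) , (λ _ → i)
    , (λ { {zero} {zero} _ → refl }) , (λ _ v _ → φ∈ v)
    where
    φ : ℕ → ℕ
    φ u with u ≟ b
    ... | yes _ = y
    ... | no _  = x
    φ∈ : ∀ u → φ u ∈ lookup H i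
    φ∈ u with u ≟ b
    ... | yes _ = y∈
    ... | no _  = x∈
    increasing : ∀ u w → InU u _ → InU w _ → u < w → φ u < φ w
    increasing u w u∈ w∈ u<w with u ≟ b | w ≟ b
    increasing u w u∈ w∈ u<w | yes refl | yes refl = contradiction u<w (<-irrefl refl)
    increasing u w u∈ w∈ u<w | no _ | yes _ = x<y
    increasing u w u∈ (here (here refl)) u<w | yes refl | no _ = contradiction (<-trans u<w (c<b (here refl))) (<-irrefl refl)
    increasing u w u∈ (here (there (here eq))) u<w | yes _ | no ¬w = contradiction eq ¬w
    increasing u w (here (here refl)) (here (here refl)) u<w | no _ | no _ = contradiction u<w (<-irrefl refl)
    increasing u w (here (there (here eq))) w∈ u<w | no ¬u | no _ = contradiction eq ¬u
    increasing u w (here (here refl)) (here (there (here eq))) u<w | no _ | no ¬w = contradiction eq ¬w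

-- An empty list of edges is contained in everything; avoiding the forest thus forces `1 ≤ q`.
no-edges⇒≻ : (F : StarForest) (H : List (List ℕ)) → StarForest.q F ≡ 0 → H ≻ StarForest.edges F
no-edges⇒≻ F H q≡0 = go (StarForest.B F) q≡0
  where
  go : ∀ bs → length bs ≡ 0 → H ≻ map (λ b → StarForest.centre F b ∷ b ∷ []) bs
  go [] _ = id , (λ u w ()) , (λ u ()) , (λ ()) , (λ { {()} }) , λ ()

-- Graphs avoiding a star forest.

module Graph (G : List (List ℕ)) (hyp : Hypergraph G) (simple : Simple G) (graph : IsGraph G) where
  open Pieces G (_∷ [])

  pieces⊆edges : Pieces⊆Edges
  pieces⊆edges = record
    { piece-sorted = λ { E∈ (here refl) → hypergraph-sorted hyp E∈ }
    ; piece-⊆ = λ { E∈ (here refl) v∈ → v∈ } }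

  -- One round is enough: if the edge joining `x` to `y` had served an earlier pick `y′`, it would
  -- contain the three vertices `x < y′ < y`.
  selectable : ∀ F → Selectable F G Adj 1
  selectable F x (y ∷ []) ps _ _ (m ∷ []) _ used with adj-edge pieces⊆edges m
  ... | i , _ , x∈ , y∈ = (y , i) , here refl , (x∈ , y∈) , All.map fresh used
    where
    fresh : ∀ {p′ : Pick F G} → proj₁ p′ ∈ lookup G (proj₂ p′) × x < proj₁ p′ × All (proj₁ p′ <_) (y ∷ []) →
      i ≢ proj₂ p′
    fresh {y′ , i′} (y′∈ , x<y′ , y′<y ∷ _) refl = 1+n≰n {2} (≤-trans
      (distinct⇒length-≤ (<⇒distinct ((x<y′ ∷ proj₁ m ∷ []) ∷ (y′<y ∷ []) ∷ [] ∷ []))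
        λ { (here refl) → x∈ ; (there (here refl)) → y′∈ ; (there (there (here refl))) → y∈ })
      (≤-reflexive (All.lookup graph (∈-lookup {xs = G} i))))

  -- Edges are cliques on two vertices, and simplicity bounds their multiplicity by 1.
  eH-≤ : ∀ {f} → (∀ {S} → S ⊆ vertices G → inc adj? S S ≤ f * length S) →
    eH G ≤ 1 + vH G * (1 + f)
  eH-≤ {f} sparse = begin
    length G                        ≡⟨ cong length (sym (concatMap-pure G)) ⟩
    length (concatMap (_∷ []) G)    ≤⟨ length-pieces pieces⊆edges {f = f} {ℓ = 2} {μ = 1} sparse
                                         (λ { E∈ (here refl) → ≤-reflexive (All.lookup graph E∈) })
                                         (λ π → ≤-trans (≤-reflexive (cong (# (π ≟ₗ_)) (concatMap-pure G)))
                                           (#-distinct (π ≟ₗ_) simple (λ e e′ → trans (sym e) e′))) ⟩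
    1 * (1 + length (vertices G) * (1 + f * (1 + f * 0))) ≡⟨ *-identityˡ _ ⟩
    1 + length (vertices G) * (1 + f * (1 + f * 0))
      ≡⟨ cong (λ z → 1 + length (vertices G) * (1 + z)) (trans (cong (λ z → f * (1 + z)) (*-zeroʳ f)) (*-identityʳ f)) ⟩
    1 + length (vertices G) * (1 + f) ≤⟨ s≤s (*-monoˡ-≤ (1 + f) (length-vertices G)) ⟩
    1 + vH G * (1 + f) ∎
    where open ≤-Reasoning

-- Cutting edges into pieces.

module ChunkPieces (ℓ : ℕ) (1≤ℓ : 1 ≤ ℓ) where

  -- An edge of at most ℓ vertices is kept whole; from a longer one the remainder is discarded,
  -- so that every proper piece has exactly ℓ vertices.
  pieces : List ℕ → List (List ℕ)
  pieces E with proj₂ (chunk ℓ E)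
  ... | []    = E ∷ []
  ... | J ∷ Z = J ∷ Z

  -- In `split`, `I` is the discarded remainder; it has at most `ℓ` vertices, no more than one
  -- proper piece, which gives the factor 2.
  data View (E : List ℕ) : List (List ℕ) → Set where
    whole : length E ≤ ℓ → View E (E ∷ [])
    split : ∀ {Z} I → I ++ concat Z ≡ E → All (λ J → length J ≡ ℓ) Z → length E ≤ 2 * ℓ * length Z → View E Z

  view : ∀ E → View E (pieces E)
  view E with proj₂ (chunk ℓ E) | concat-chunks 1≤ℓ E | length-tail-chunks 1≤ℓ E | #chunks 1≤ℓ E | length-head-chunk 1≤ℓ E
  ... | []    | _ | _  | l | I≤ℓ = whole (≤-trans (≤-reflexive (trans (sym l) (+-identityʳ _))) I≤ℓ)
  ... | J ∷ Z | e | ls | l | I≤ℓ = split (proj₁ (chunk ℓ E)) e ls (begin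
    length E                                         ≡⟨ sym l ⟩
    length (proj₁ (chunk ℓ E)) + (ℓ + length Z * ℓ)  ≤⟨ +-monoˡ-≤ _ (≤-trans I≤ℓ (m≤m+n ℓ (length Z * ℓ))) ⟩
    (ℓ + length Z * ℓ) + (ℓ + length Z * ℓ)          ≡⟨ double ℓ (length Z) ⟩
    2 * ℓ * suc (length Z)                           ∎)
    where
    open ≤-Reasoning
    double : ∀ ℓ z → (ℓ + z * ℓ) + (ℓ + z * ℓ) ≡ 2 * ℓ * suc z
    double = solve-∀

  length-pieces-≥ : ∀ E → length E ≤ 2 * ℓ * length (pieces E)
  length-pieces-≥ E with pieces E | view E
  ... | _ | whole l       = ≤-trans l (≤-trans (m≤n*m ℓ 2) (≤-reflexive (sym (*-identityʳ _))))
  ... | _ | split _ _ _ l = l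

  concat-sorted : ∀ {E} → AllPairs _<_ E → AllPairs _<_ (concat (pieces E))
  concat-sorted {E} s with pieces E | view E
  ... | _ | whole _          = subst (AllPairs _<_) (sym (++-identityʳ E)) s
  ... | _ | split I refl _ _ = proj₁ (proj₂ (AllPairs-++⁻ I s))

  pieces-short : ∀ E → All (λ π → length π ≤ ℓ) (pieces E)
  pieces-short E with pieces E | view E
  ... | _ | whole l        = l ∷ []
  ... | _ | split _ _ ls _ = All.map ≤-reflexive ls

  pieces-⊆ : ∀ E {π v} → π ∈ pieces E → v ∈ π → v ∈ E
  pieces-⊆ E π∈ v∈ with pieces E | view E
  pieces-⊆ E (here refl) v∈ | _ | whole _          = v∈
  pieces-⊆ E π∈          v∈ | _ | split I refl _ _ = ∈-++⁺ʳ I (∈-concat⁺′ v∈ π∈)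

  short-piece : ∀ E {π} → π ∈ pieces E → length π ≢ ℓ → π ≡ E
  short-piece E π∈ l≢ with pieces E | view E
  short-piece E (here refl) l≢ | _ | whole _        = refl
  short-piece E π∈          l≢ | _ | split _ _ ls _ = contradiction (All.lookup ls π∈) l≢

  piece-sorted : ∀ {E} → AllPairs _<_ E → ∀ {π} → π ∈ pieces E → AllPairs _<_ π
  piece-sorted {E} s = go (pieces E) (concat-sorted s)
    where
    go : ∀ Z → AllPairs _<_ (concat Z) → ∀ {π} → π ∈ Z → AllPairs _<_ π
    go (I ∷ Z) s (here refl) = proj₁ (AllPairs-++⁻ I s)
    go (I ∷ Z) s (there π∈)  = go Z (proj₁ (proj₂ (AllPairs-++⁻ I s))) π∈

  pieces-distinct : ∀ {E} → AllPairs _<_ E → AllPairs _≢_ (pieces E)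
  pieces-distinct {E} s with pieces E | view E
  ... | _ | whole _           = [] ∷ []
  ... | Z | split I refl ls _ = go Z (proj₁ (proj₂ (AllPairs-++⁻ I s))) ls
    where
    go : ∀ Z → AllPairs _<_ (concat Z) → All (λ J → length J ≡ ℓ) Z → AllPairs _≢_ Z
    go []            _ _        = []
    go ([] ∷ Z)      _ (l ∷ _)  = contradiction (subst (1 ≤_) (sym l) 1≤ℓ) λ ()
    go ((v ∷ I) ∷ Z) s (_ ∷ ls) with AllPairs-++⁻ (v ∷ I) s
    ... | _ , s′ , v< ∷ _ = All.tabulate (λ { J∈ refl → <-irrefl refl (All.lookup v< (∈-concat⁺′ (here refl) J∈)) })
      ∷ go Z s′ ls

  others : ℕ → List ℕ → List ℕ
  others x E = filter (λ y → ¬? (x ≟ y)) (concat (filter (x ∈?_) (pieces E)))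

  ∈-others : ∀ {x y E} → x ≢ y → Any (λ π → x ∈ π × y ∈ π) (pieces E) → y ∈ others x E
  ∈-others {x} {E = E} x≢y tog with find tog
  ... | π , π∈ , x∈ , y∈ = ∈-filter⁺ (λ y → ¬? (x ≟ y)) (∈-concat⁺′ y∈ (∈-filter⁺ (x ∈?_) π∈ x∈)) x≢y

  -- x lies in at most one piece of E.
  length-others : ∀ x {E} → AllPairs _<_ E → length (others x E) ≤ ℓ ∸ 1
  length-others x {E} s = go (pieces E) (concat-sorted s) (pieces-short E)
    where
    ≢x? = λ y → ¬? (x ≟ y)
    none : ∀ Z → x ∉ concat Z → filter (x ∈?_) Z ≡ []
    none []      _  = refl
    none (I ∷ Z) x∉ with x ∈? I
    ... | yes x∈ = contradiction (∈-++⁺ˡ x∈) x∉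
    ... | no _   = none Z (x∉ ∘ ∈-++⁺ʳ I)
    fewer : ∀ I → x ∈ I → length (filter ≢x? I) < length I
    fewer I x∈ = filter-notAll ≢x? I (Any.map (λ { refl ¬x → ¬x refl }) x∈)
    go : ∀ Z → AllPairs _<_ (concat Z) → All (λ π → length π ≤ ℓ) Z →
      length (filter ≢x? (concat (filter (x ∈?_) Z))) ≤ ℓ ∸ 1
    go []      _ _ = z≤n
    go (I ∷ Z) s (l ∷ ls) with AllPairs-++⁻ I s | x ∈? I
    ... | _ , s′ , _  | no _ = go Z s′ ls
    ... | _ , _ , I<Z | yes x∈ rewrite none Z (λ x∈Z → <-irrefl refl (All.lookup (All.lookup I<Z x∈) x∈Z)) | ++-identityʳ I =
      ∸-monoˡ-≤ 1 (≤-trans (fewer I x∈) l)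

-- Hypergraphs avoiding a star forest.

#-map : {A B : Set} {P : B → Set} (P? : Decidable P) (f : A → B) (xs : List A) → # P? (map f xs) ≡ # (P? ∘ f) xs
#-map P? f []       = refl
#-map P? f (x ∷ xs) = trans (#-∷ P? (f x) (map f xs))
  (trans (cong (ind (P? (f x)) +_) (#-map P? f xs)) (sym (#-∷ (P? ∘ f) x xs)))

#-concat : {A : Set} {P : A → Set} (P? : Decidable P) (Z : List (List A)) → # P? (concat Z) ≡ ∑ (# P?) Z
#-concat P? []      = refl
#-concat P? (I ∷ Z) = trans (#-++ P? I (concat Z)) (cong (# P? I +_) (#-concat P? Z))

∑-map : {A B : Set} (g : B → ℕ) (f : A → B) (xs : List A) → ∑ g (map f xs) ≡ ∑ (g ∘ f) xs
∑-map g f xs = cong sum (sym (map-∘ xs))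

#-mono : {A : Set} {P Q : A → Set} (P? : Decidable P) (Q? : Decidable Q) (xs : List A) →
  (∀ {x} → x ∈ xs → P x → Q x) → # P? xs ≤ # Q? xs
#-mono P? Q? []       h = z≤n
#-mono P? Q? (x ∷ xs) h with P? x | Q? x
... | yes _ | yes _ = s≤s (#-mono P? Q? xs (h ∘ there))
... | yes p | no ¬q = contradiction (h (here refl) p) ¬q
... | no _  | yes _ = ≤-trans (#-mono P? Q? xs (h ∘ there)) (n≤1+n _)
... | no _  | no _  = #-mono P? Q? xs (h ∘ there)

module Hyper (F : StarForest) (H : List (List ℕ)) (hyp : Hypergraph H) (simple : Simple H)
             (¬H≻F : ¬ (H ≻ StarForest.edges F)) (1≤q : 1 ≤ StarForest.q F) where
  open StarForest F

  1≤p : 1 ≤ p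
  1≤p = ≤-trans 1≤q (m≤n+m q r)

  open ChunkPieces p 1≤p
  open Pieces H pieces

  sorted : ∀ {E} → E ∈ H → AllPairs _<_ E
  sorted = hypergraph-sorted hyp

  pieces⊆edges : Pieces⊆Edges
  pieces⊆edges = record
    { piece-sorted = λ E∈ → piece-sorted (sorted E∈)
    ; piece-⊆ = λ {E} _ → pieces-⊆ E }

  Coloured : ℕ → Pick F H → Set
  Coloured x (y , i) = Covers F H x (y , i) × y ∈ others x (lookup H i)

  colour : ∀ {x} ys → All (Adj x) ys →
    Σ (List (Pick F H)) λ zs → map proj₁ zs ≡ ys × All (Coloured x) zs
  colour []       []       = [] , refl , []
  colour (y ∷ ys) (m ∷ ms) with adj-edge pieces⊆edges m | colour ys ms
  ... | i , tog , x∈ , y∈ | zs , refl , cs =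
    (y , i) ∷ zs , refl , ((x∈ , y∈) , ∈-others (<⇒≢ (proj₁ m)) tog) ∷ cs

  length-concatMap-others : ∀ x (ps : List (Pick F H)) →
    length (concatMap (λ p′ → others x (lookup H (proj₂ p′))) ps) ≤ (p ∸ 1) * length ps
  length-concatMap-others x []             = z≤n
  length-concatMap-others x ((y , i) ∷ ps) = begin
    length (others x (lookup H i) ++ concatMap (λ p′ → others x (lookup H (proj₂ p′))) ps)
      ≡⟨ length-++ (others x (lookup H i)) ⟩
    _ ≤⟨ +-mono-≤ (length-others x (sorted (∈-lookup {xs = H} i))) (length-concatMap-others x ps) ⟩
    (p ∸ 1) + (p ∸ 1) * length ps
      ≡⟨ sym (*-suc (p ∸ 1) (length ps)) ⟩
    (p ∸ 1) * suc (length ps) ∎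
    where open ≤-Reasoning

  -- Pigeonhole: a used edge accounts for at most `p ∸ 1` neighbours of `x`, and at most `q ∸ 1`
  -- edges are used, so one of `(p ∸ 1) * (q ∸ 1) + 1` neighbours has a fresh colour.
  selectable : Selectable F H Adj t
  selectable x ys ps #ys ys-sorted ms #ps _ with colour ys ms
  ... | zs , refl , cs with any? (λ z → All.all? (λ p′ → ¬? (proj₂ z Fin.≟ proj₂ p′)) ps) zs
  ...   | yes fresh = let (z , z∈ , f) = find fresh in
    z , ∈-map⁺ proj₁ z∈ , proj₁ (All.lookup cs z∈) , f
  ...   | no ¬fresh = contradiction (begin
      (p ∸ 1) * (q ∸ 1) + 1   ≡⟨ sym #ys ⟩
      length (map proj₁ zs)   ≤⟨ distinct⇒length-≤ (<⇒distinct ys-sorted) blocked ⟩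
      length (concatMap (λ p′ → others x (lookup H (proj₂ p′))) ps)
                              ≤⟨ length-concatMap-others x ps ⟩
      (p ∸ 1) * length ps     ≤⟨ *-monoʳ-≤ (p ∸ 1) (∸-monoˡ-≤ 1 #ps) ⟩
      (p ∸ 1) * (q ∸ 1)       ∎) (m+1+n≰m ((p ∸ 1) * (q ∸ 1)))
    where
    open ≤-Reasoning
    blocked : ∀ {y} → y ∈ map proj₁ zs → y ∈ concatMap (λ p′ → others x (lookup H (proj₂ p′))) ps
    blocked y∈ with ∈-map⁻ proj₁ y∈
    ... | (y , i) , z∈ , refl = ∈-concatMap⁺ (λ p′ → others x (lookup H (proj₂ p′)))
      (Any.map (λ { refl → proj₂ (All.lookup cs z∈) })
        (Any.map (λ {p′} → decidable-stable (i Fin.≟ proj₂ p′))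
          (All.¬All⇒Any¬ (λ p′ → ¬? (i Fin.≟ proj₂ p′)) ps (λ f → ¬fresh (lose z∈ f)))))

  hit? : ∀ π → Decidable (λ E → Any (π ≡_) (pieces E))
  hit? π E = any? (π ≟ₗ_) (pieces E)

  -- The pieces of one edge are pairwise distinct, so each edge yields `π` at most once.
  mult≤hits : ∀ π → mult π (concatMap pieces H) ≤ # (hit? π) H
  mult≤hits π = begin
    mult π (concatMap pieces H)   ≡⟨ trans (#-concat (π ≟ₗ_) (map pieces H)) (∑-map _ pieces H) ⟩
    ∑ (λ E → mult π (pieces E)) H ≤⟨ ∑-mono _ _ H (λ { P E S refl → once (sorted (∈-++⁺ʳ P (here refl))) }) ⟩
    ∑ (ind ∘ hit? π) H            ≡⟨ sym (#≡∑ (hit? π) H) ⟩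
    # (hit? π) H                  ∎
    where
    open ≤-Reasoning
    once : ∀ {E} → AllPairs _<_ E → mult π (pieces E) ≤ ind (hit? π E)
    once {E} s with hit? π E
    ... | yes _ = #-distinct (π ≟ₗ_) (pieces-distinct s) (λ e e′ → trans (sym e) e′)
    ... | no ¬h = ≤-reflexive (¬Any⇒#≡0 (π ≟ₗ_) (pieces E) ¬h)

  -- A piece that does not have `p` vertices is a whole edge, hit once by simplicity; a piece with
  -- `p` vertices in more than `q` edges would give a copy through `common-vertices⇒≻`.
  hits≤q : ∀ π → # (hit? π) H ≤ q
  hits≤q π with length π ≟ p
  ... | no ≢p = begin
    # (hit? π) H   ≤⟨ #-mono (hit? π) (π ≟ₗ_) H (λ {E} _ h → short-piece E h ≢p) ⟩
    # (π ≟ₗ_) H    ≤⟨ #-distinct (π ≟ₗ_) simple (λ e e′ → trans (sym e) e′) ⟩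
    1              ≤⟨ 1≤q ⟩
    q              ∎
    where open ≤-Reasoning
  ... | yes ≡p = ≮⇒≥ λ q< → ¬H≻F (common-vertices⇒≻ F H π (π-sorted (≤-trans (s≤s z≤n) q<)) ≡p
    (take q is) (AllPairs-resp-⊆ (take-⊆ q is) (AllPairs.filter⁺ (hit? π ∘ lookup H) (Unique.allFin⁺ (length H))))
    (trans (length-take q is) (m≤n⇒m⊓n≡m (≤-trans (<⇒≤ q<) (≤-reflexive #is))))
    (All-resp-⊆ (take-⊆ q is) (All.map (λ {i} h → All.tabulate (pieces-⊆ (lookup H i) h)) (All.all-filter (hit? π ∘ lookup H) (allFin (length H))))))
    where
    is = filter (hit? π ∘ lookup H) (allFin (length H))
    -- The embedding asks for distinct indices, so the count of edges is transferred to `allFin`.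
    #is : # (hit? π) H ≡ length is
    #is = trans (cong (# (hit? π)) (sym (trans (map-tabulate id (lookup H)) (tabulate-lookup H))))
                (#-map (hit? π) (lookup H) (allFin (length H)))
    π-sorted : 1 ≤ # (hit? π) H → AllPairs _<_ π
    π-sorted h = let (E , E∈ , π∈) = find (#-pos⇒Any (hit? π) H h) in piece-sorted (sorted E∈) π∈

  -- An edge has at most `2 * p` vertices per piece, and pieces are cliques of at most `p` vertices
  -- with multiplicity at most `q`.
  iH-≤ : ∀ {f} → (∀ {S} → S ⊆ vertices H → inc adj? S S ≤ f * length S) →
    iH H ≤ 2 * p * (q * (1 + vH H * cliqueRate f p))
  iH-≤ {f} sparse = begin
    ∑ length H                                ≤⟨ ∑-mono _ _ H (λ _ E _ _ → length-pieces-≥ E) ⟩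
    ∑ (λ E → 2 * p * length (pieces E)) H     ≡⟨ ∑-* (2 * p) _ H ⟩
    2 * p * ∑ (λ E → length (pieces E)) H     ≡⟨ cong (2 * p *_) (trans (sym (∑-map length pieces H)) (∑-length-concat (map pieces H))) ⟩
    2 * p * length (concatMap pieces H)
      ≤⟨ *-monoʳ-≤ (2 * p) (length-pieces pieces⊆edges {f = f} {ℓ = p} {μ = q} sparse
           (λ {E} _ π∈ → All.lookup (pieces-short E) π∈) (λ π → ≤-trans (mult≤hits π) (hits≤q π))) ⟩
    2 * p * (q * (1 + length (vertices H) * cliqueRate f p))
      ≤⟨ *-monoʳ-≤ (2 * p) (*-monoʳ-≤ q (s≤s (*-monoˡ-≤ (cliqueRate f p) (length-vertices H)))) ⟩
    2 * p * (q * (1 + vH H * cliqueRate f p)) ∎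
    where open ≤-Reasoning

  eH≤iH : eH H ≤ iH H
  eH≤iH = ≤-trans (≤-reflexive (sym (∑-1 H)))
    (∑-mono _ _ H λ { P E S refl → nonempty (proj₂ (All.lookup hyp (∈-++⁺ʳ P (here refl)))) })
    where
    nonempty : ∀ {E : List ℕ} → E ≢ [] → 1 ≤ length E
    nonempty {[]}    ≢[] = contradiction refl ≢[]
    nonempty {_ ∷ _} _   = s≤s z≤n

-- Numerical estimates.

cliqueRate-≤ : ∀ f ℓ → cliqueRate f ℓ ≤ (1 + f) ^ ℓ
cliqueRate-≤ f zero    = z≤n
cliqueRate-≤ f (suc ℓ) = +-mono-≤ (m^n>0 (1 + f) ℓ) (*-monoʳ-≤ f (cliqueRate-≤ f ℓ))

n<2^n : ∀ n → n < 2 ^ n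
n<2^n zero    = s≤s z≤n
n<2^n (suc n) = begin
  2 + n         ≤⟨ s≤s (n<2^n n) ⟩
  1 + 2 ^ n     ≤⟨ +-monoˡ-≤ (2 ^ n) (m^n>0 2 n) ⟩
  2 ^ n + 2 ^ n ≡⟨ cong (2 ^ n +_) (sym (+-identityʳ (2 ^ n))) ⟩
  2 ^ suc n     ∎
  where open ≤-Reasoning

-- Bounding `1 + W` by `2 ^ W` puts everything under one power, and `16 * 2 ^ s ≤ 10 * 10 ^ s` holds
-- from `s = 1` on.
density-≤ : ∀ r s a → 1 ≤ r → 1 ≤ s → density r s a ≤ (10 * r) ^ (suc s * a ^ s)
density-≤ r s a 1≤r 1≤s = begin
  (r * 2 ^ (s + 3)) ^ W * (1 + W)   ≤⟨ *-monoʳ-≤ ((r * 2 ^ (s + 3)) ^ W) (n<2^n W) ⟩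
  (r * 2 ^ (s + 3)) ^ W * 2 ^ W     ≡⟨ sym (^-distribʳ-* W (r * 2 ^ (s + 3)) 2) ⟩
  (r * 2 ^ (s + 3) * 2) ^ W         ≤⟨ ^-monoˡ-≤ W (base s 1≤s) ⟩
  ((10 * r) ^ suc s) ^ W            ≡⟨ ^-*-assoc (10 * r) (suc s) W ⟩
  (10 * r) ^ (suc s * W)            ∎
  where
  open ≤-Reasoning
  W = a ^ s
  powers : ∀ s → 1 ≤ s → 16 * 2 ^ s ≤ 10 * 10 ^ s
  powers 1             _ = m≤m+n 32 68
  powers (suc (suc s)) _ = begin
    16 * (2 * 2 ^ suc s)   ≡⟨ swap 16 2 (2 ^ suc s) ⟩
    2 * (16 * 2 ^ suc s)   ≤⟨ *-mono-≤ (m≤m+n 2 8) (powers (suc s) (s≤s z≤n)) ⟩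
    10 * (10 * 10 ^ suc s) ∎
    where
    swap : ∀ a b c → a * (b * c) ≡ b * (a * c)
    swap = solve-∀
  base : ∀ s → 1 ≤ s → r * 2 ^ (s + 3) * 2 ≤ (10 * r) ^ suc s
  base s 1≤s = begin
    r * 2 ^ (s + 3) * 2     ≡⟨ cong (λ z → r * z * 2) (^-distribˡ-+-* 2 s 3) ⟩
    r * (2 ^ s * 8) * 2     ≡⟨ regroup r (2 ^ s) ⟩
    r * (16 * 2 ^ s)        ≤⟨ *-monoʳ-≤ r (powers s 1≤s) ⟩
    r * (10 * 10 ^ s)       ≡⟨ regroup′ r (10 ^ s) ⟩
    10 * r * 10 ^ s         ≤⟨ *-monoʳ-≤ (10 * r) (^-monoˡ-≤ s (m≤m*n 10 r)) ⟩
    10 * r * (10 * r) ^ s   ∎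
    where
    instance _ = >-nonZero 1≤r
    regroup : ∀ r x → r * (x * 8) * 2 ≡ r * (16 * x)
    regroup = solve-∀
    regroup′ : ∀ r x → r * (10 * x) ≡ 10 * r * x
    regroup′ = solve-∀

-- Put `s = 2 + j` and `x = 2 ^ j`. The square is at most `16 * x ^ 2`; the summand 8 and the power
-- `a ^ (1 + 3 * j)` left over by `4 * s ≤ kl` cover it, as `2 ≤ a`.
exponent-≤ : ∀ s a kl → 2 ≤ s → 2 ≤ a → 4 * s ≤ kl →
  (2 + s) * (2 + s) * a ^ s ≤ (2 * a + 8) * a ^ (kl ∸ 5)
exponent-≤ (suc (suc j)) a kl (s≤s (s≤s z≤n)) 2≤a l = begin
  (4 + j) * (4 + j) * W              ≤⟨ *-monoˡ-≤ W (*-mono-≤ 4+j≤ 4+j≤) ⟩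
  4 * x * (4 * x) * W                ≤⟨ *-monoˡ-≤ W (m≤m*n (4 * x * (4 * x)) x) ⟩
  4 * x * (4 * x) * x * W            ≡⟨ regroup x W ⟩
  8 * (W * (2 * (x * (x * x))))      ≤⟨ *-mono-≤ (m≤n+m 8 (2 * a)) (*-monoʳ-≤ W rest) ⟩
  (2 * a + 8) * (W * a ^ (1 + (j + (j + j)))) ≡⟨ cong ((2 * a + 8) *_) (sym (^-distribˡ-+-* a (2 + j) (1 + (j + (j + j))))) ⟩
  (2 * a + 8) * a ^ (2 + j + (1 + (j + (j + j)))) ≤⟨ *-monoʳ-≤ (2 * a + 8) (^-monoʳ-≤ a exps) ⟩
  (2 * a + 8) * a ^ (kl ∸ 5)         ∎
  where
  open ≤-Reasoning
  W = a ^ (2 + j)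
  x = 2 ^ j
  instance _ = >-nonZero (≤-trans (s≤s (z≤n {1})) 2≤a)
  instance _ = m^n≢0 2 j
  4+j≤ : 4 + j ≤ 4 * x
  4+j≤ = begin
    4 + j         ≤⟨ +-monoʳ-≤ 4 (m≤n*m j 4) ⟩
    4 + 4 * j     ≡⟨ sym (*-suc 4 j) ⟩
    4 * suc j     ≤⟨ *-monoʳ-≤ 4 (n<2^n j) ⟩
    4 * x         ∎
  regroup : ∀ x w → 4 * x * (4 * x) * x * w ≡ 8 * (w * (2 * (x * (x * x))))
  regroup = solve-∀
  rest : 2 * (x * (x * x)) ≤ a ^ (1 + (j + (j + j)))
  rest = begin
    2 * (x * (x * x))           ≡⟨ cong (2 *_) (sym (trans (^-distribˡ-+-* 2 j (j + j)) (cong (x *_) (^-distribˡ-+-* 2 j j)))) ⟩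
    2 ^ (1 + (j + (j + j)))     ≤⟨ ^-monoˡ-≤ (1 + (j + (j + j))) 2≤a ⟩
    a ^ (1 + (j + (j + j)))     ∎
  exps : 2 + j + (1 + (j + (j + j))) ≤ kl ∸ 5
  exps = ≤-trans (≤-reflexive (sym (trans (cong (_∸ 5) (eq j)) (m+n∸n≡m _ 5)))) (∸-monoˡ-≤ 5 l)
    where
    eq : ∀ j → 4 * (2 + j) ≡ 2 + j + (1 + (j + (j + j))) + 5
    eq = solve-∀

LtPlus-mono : ∀ {x y} s X → x ≤ y → LtPlus y s X → LtPlus x s X
LtPlus-mono s X x≤y (inj₁ y<s) = inj₁ (≤-<-trans x≤y y<s)
LtPlus-mono s (pow co d b e D) x≤y (inj₂ h) = inj₂ (≤-<-trans (^-monoˡ-≤ D (*-monoˡ-≤ d (∸-monoˡ-≤ s x≤y))) h)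

LtPlus-integral : ∀ {x s co d b e D} → d ≡ 1 → D ≡ 1 → x < co * b ^ e → LtPlus x s (pow co d b e D)
LtPlus-integral {x} {s} {co} {b = b} {e} refl refl h = inj₂ (begin-strict
  ((x ∸ s) * 1) ^ 1   ≡⟨ trans (^-identityʳ _) (*-identityʳ (x ∸ s)) ⟩
  x ∸ s               ≤⟨ m∸n≤m x s ⟩
  x                   <⟨ h ⟩
  co * b ^ e          ≡⟨ cong (_* b ^ e) (sym (^-identityʳ co)) ⟩
  co ^ 1 * b ^ e      ∎)
  where open ≤-Reasoning

-- Serves the case of a fractional exponent (`kl < 5`): the coefficient alone exceeds `x`, and a
-- power of `b` is at least 1.
LtPlus-coefficient : ∀ {x co d b e D} → d ≡ 1 → 1 ≤ D → 1 ≤ b → x < co → LtPlus x 0 (pow co d b e D)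
LtPlus-coefficient {x} {co} {b = b} {e} {D} refl 1≤D 1≤b h = inj₂ (begin-strict
  (x * 1) ^ D         ≡⟨ cong (_^ D) (*-identityʳ x) ⟩
  x ^ D               <⟨ ^-monoˡ-< D h ⟩
  co ^ D              ≤⟨ m≤m*n (co ^ D) (b ^ e) ⟩
  co ^ D * b ^ e      ∎)
  where
  open ≤-Reasoning
  instance _ = >-nonZero 1≤D
  instance _ = >-nonZero 1≤b
  instance _ = m^n≢0 b e

adj⇒single-edge≻ : ∀ (F : StarForest) {H pieces} → Pieces.Pieces⊆Edges H pieces → StarForest.q F ≡ 1 →
  ∀ {x y} → Pieces.Adj H pieces x y → H ≻ StarForest.edges F
adj⇒single-edge≻ F {H} {pieces} wf q≡1 m with Pieces.adj-edge H pieces wf m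
... | i , _ , x∈ , y∈ = single-edge⇒≻ F H q≡1 (proj₁ m) i x∈ y∈

∑-≡0 : {A : Set} {f : A → ℕ} (xs : List A) → (∀ x → f x ≡ 0) → ∑ f xs ≡ 0
∑-≡0 []       h = refl
∑-≡0 (x ∷ xs) h = cong₂ _+_ (h x) (∑-≡0 xs h)

inc-empty : {A Blk : Set} {M : A → Blk → Set} (M? : B.Decidable M) (X : List A) (Y : List Blk) →
  (∀ {x y} → ¬ M x y) → inc M? X Y ≡ 0
inc-empty M? X Y ¬M = ∑-≡0 Y λ y → ¬Any⇒#≡0 (λ x → M? x y) X (λ any → ¬M (proj₂ (Any.satisfied any)))

-- The bounds in terms of `β`.

module Bounding (F : StarForest) (2≤r : 2 ≤ StarForest.r F) where
  open StarForest F

  b : ℕ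
  b = 10 * r

  1≤r : 1 ≤ r
  1≤r = ≤-trans (s≤s z≤n) 2≤r

  1≤b : 1 ≤ b
  1≤b = *-mono-≤ (s≤s {n = 9} z≤n) 1≤r

  instance
    b≢0 : NonZero b
    b≢0 = >-nonZero 1≤b

  -- Here `kl ≥ 8`, so `β` has no denominators. Its coefficient is at least 4, which absorbs the
  -- lower-order terms of `eH-≤`.
  graph-bound : 2 ≤ q → ∀ n → 1 ≤ n → ∀ a → IsAlpha n a → ∀ G → Hypergraph G → Simple G → IsGraph G →
    vH G ≤ n → ¬ (G ≻ edges) → LtPlus (eH G) ((r ∸ 1) * n) (scale n (β r (2 * q) a))
  graph-bound 2≤q n 1≤n a (1≤a , n≤A , _) G hyp simple graph v≤n ¬G≻F =
    LtPlus-integral {s = (r ∸ 1) * n} {e = e}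
      (cong (2 ^_) (m≤n⇒m∸n≡0 (≤-trans (m≤m+n 3 5) 8≤kl))) (cong (a ^_) (m≤n⇒m∸n≡0 (≤-trans (m≤m+n 5 3) 8≤kl))) (begin-strict
        eH G                                 ≤⟨ eH≤ a 1≤a n≤A ⟩
        1 + n * (1 + b ^ e)                  <⟨ slack n (b ^ e) 1≤n (m^n>0 b e) ⟩
        n * 4 * b ^ e                        ≤⟨ *-monoˡ-≤ (b ^ e) (*-monoʳ-≤ n (*-mono-≤ 2≤r (^-monoʳ-≤ 2 {1} (∸-monoˡ-≤ 3 (≤-trans (m≤m+n 4 4) 8≤kl))))) ⟩
        n * (r * 2 ^ (kl ∸ 3)) * b ^ e       ∎)
    where
    open ≤-Reasoning
    open Graph G hyp simple graph
    open Pieces G (_∷ [])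
    kl = r * (2 * q)
    e = (2 * a + 8) * a ^ (kl ∸ 5)
    4q≤kl : 4 * q ≤ kl
    4q≤kl = ≤-trans (≤-reflexive (*-assoc 2 2 q)) (*-monoˡ-≤ (2 * q) 2≤r)
    8≤kl : 8 ≤ kl
    8≤kl = ≤-trans (*-monoʳ-≤ 4 2≤q) 4q≤kl
    slack : ∀ n B → 1 ≤ n → 1 ≤ B → 1 + n * (1 + B) < n * 4 * B
    slack n B 1≤n 1≤B = begin-strict
      1 + n * (1 + B)       ≤⟨ +-mono-≤ (*-mono-≤ 1≤n 1≤B) (*-monoʳ-≤ n (+-monoˡ-≤ B 1≤B)) ⟩
      n * B + n * (B + B)   <⟨ m<m+n (n * B + n * (B + B)) (*-mono-≤ 1≤n 1≤B) ⟩
      n * B + n * (B + B) + n * B ≡⟨ eq n B ⟩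
      n * 4 * B             ∎
      where
      eq : ∀ n B → n * B + n * (B + B) + n * B ≡ n * 4 * B
      eq = solve-∀
    from-sparse : ∀ f {B} → (∀ {S} → S ⊆ vertices G → inc adj? S S ≤ f * length S) → f ≤ B →
      eH G ≤ 1 + n * (1 + B)
    from-sparse f sparse f≤ = ≤-trans (eH-≤ {f} sparse) (s≤s (*-mono-≤ v≤n (s≤s f≤)))
    eH≤ : ∀ a → 1 ≤ a → n ≤ Ack a → eH G ≤ 1 + n * (1 + b ^ ((2 * a + 8) * a ^ (kl ∸ 5)))
    -- `Ack 1 = 2`, so there are at most two vertices.
    eH≤ 1 _ n≤2 = from-sparse 2
      (λ {S} τ → sparse-≤ {S} (≤-trans (length-mono-≤ τ) (≤-trans (length-vertices G) (≤-trans v≤n n≤2))))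
      (begin
        2         ≤⟨ *-mono-≤ (m≤m+n 2 8) 1≤r ⟩
        b         ≡⟨ sym (^-identityʳ b) ⟩
        b ^ 1     ≤⟨ ^-monoʳ-≤ b (*-mono-≤ (s≤s {n = 9} z≤n) (m^n>0 1 (kl ∸ 5))) ⟩
        b ^ (10 * 1 ^ (kl ∸ 5)) ∎)
    eH≤ (suc (suc k)) _ n≤A = from-sparse (density r (q * 1) (2 + k))
      (sparse-density F ¬G≻F {t = 1} {k} {n} 1≤r (≤-trans (s≤s z≤n) 2≤s) (selectable F) v≤n n≤A)
      (begin
        density r s a′                    ≤⟨ density-≤ r s a′ 1≤r (≤-trans (s≤s z≤n) 2≤s) ⟩
        b ^ (suc s * a′ ^ s)              ≤⟨ ^-monoʳ-≤ b (*-monoˡ-≤ (a′ ^ s) (≤-trans (n≤1+n (suc s)) (m≤m*n (2 + s) (2 + s)))) ⟩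
        b ^ ((2 + s) * (2 + s) * a′ ^ s)  ≤⟨ ^-monoʳ-≤ b (exponent-≤ s a′ kl 2≤s (s≤s (s≤s z≤n)) (≤-trans (*-monoʳ-≤ 4 (≤-reflexive (*-identityʳ q))) 4q≤kl)) ⟩
        b ^ ((2 * a′ + 8) * a′ ^ (kl ∸ 5)) ∎)
      where
      s = q * 1
      a′ = 2 + k
      2≤s : 2 ≤ s
      2≤s = ≤-trans 2≤q (≤-reflexive (sym (*-identityʳ q)))

  -- Any edge would be a copy of the forest, so `G` is empty, and `(r ∸ 1) * n` is positive.
  graph-bound-1 : q ≡ 1 → ∀ n → 1 ≤ n → ∀ G → Hypergraph G → Simple G → IsGraph G →
    ¬ (G ≻ edges) → ∀ X → LtPlus (eH G) ((r ∸ 1) * n) X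
  graph-bound-1 q≡1 n 1≤n []      _ _ _ _ X = inj₁ (*-mono-≤ (∸-monoˡ-≤ 1 2≤r) 1≤n)
  graph-bound-1 q≡1 n 1≤n ((x ∷ y ∷ []) ∷ G) hyp simple graph ¬G≻F X =
    contradiction (single-edge⇒≻ F _ q≡1 (All.head (AllPairs.head (hypergraph-sorted hyp (here refl)))) zero (here refl) (there (here refl))) ¬G≻F
  graph-bound-1 q≡1 n 1≤n ([] ∷ G) _ _ (() ∷ _)
  graph-bound-1 q≡1 n 1≤n ((_ ∷ []) ∷ G) _ _ (() ∷ _)
  graph-bound-1 q≡1 n 1≤n ((_ ∷ _ ∷ _ ∷ _) ∷ G) _ _ (() ∷ _)

  -- `2 * p` and `q` come from `iH-≤`, the last 2 merges its two summands, and the leading 1 makes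
  -- the inequality strict.
  c : ℕ
  c = 1 + 2 * p * (q * 2)

  module _ (1≤q : 1 ≤ q) (n : ℕ) (3≤n : 3 ≤ n) (a : ℕ) (alpha : IsAlpha n a) (H : List (List ℕ))
           (hyp : Hypergraph H) (simple : Simple H) (v≤n : vH H ≤ n) (¬H≻F : ¬ (H ≻ edges)) where
    open Hyper F H hyp simple ¬H≻F 1≤q
    open ChunkPieces p 1≤p using (pieces)
    open Pieces H pieces
    open ≤-Reasoning

    private
      kl = r * (2 * t * q)
      e = (2 * a + 8) * a ^ (kl ∸ 5)
      coef = (r * 2 ^ (kl ∸ 3)) ^ 3

      1≤n : 1 ≤ n
      1≤n = ≤-trans (s≤s z≤n) 3≤n

      1≤coef : 1 ≤ coef
      1≤coef = ^-monoˡ-≤ 3 (*-mono-≤ 1≤r (m^n>0 2 (kl ∸ 3)))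

      4tq≤kl : 4 * (q * t) ≤ kl
      4tq≤kl = ≤-trans (≤-reflexive (eq q t)) (*-monoˡ-≤ (2 * t * q) 2≤r)
        where
        eq : ∀ q t → 4 * (q * t) ≡ 2 * (2 * t * q)
        eq = solve-∀

    iH-< : ∀ f {B} → (∀ {S} → S ⊆ vertices H → inc adj? S S ≤ f * length S) → 1 ≤ B →
      (1 + f) ^ p ≤ B → iH H < c * n * coef * B
    iH-< f {B} sparse 1≤B f≤B = begin-strict
      iH H                                      ≤⟨ iH-≤ {f} sparse ⟩
      2 * p * (q * (1 + vH H * cliqueRate f p)) ≤⟨ *-monoʳ-≤ (2 * p) (*-monoʳ-≤ q (+-mono-≤ (*-mono-≤ 1≤n 1≤B)
                                                     (*-mono-≤ v≤n (≤-trans (cliqueRate-≤ f p) f≤B)))) ⟩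
      2 * p * (q * (n * B + n * B))             <⟨ m<n+m _ (*-mono-≤ 1≤n 1≤B) ⟩
      n * B + 2 * p * (q * (n * B + n * B))     ≡⟨ eq (2 * p) q n B ⟩
      c * n * B                                 ≤⟨ *-monoˡ-≤ B (m≤m*n (c * n) coef) ⟩
      c * n * coef * B                          ∎
      where
      instance _ = >-nonZero 1≤coef
      eq : ∀ m q n B → n * B + m * (q * (n * B + n * B)) ≡ (1 + m * (q * 2)) * n * B
      eq = solve-∀

    -- Adjacent vertices would give a copy, so the shadow graph is empty and `f = 0` is admissible.
    -- For `r = 2` one has `kl = 4`, hence the lemma for fractional exponents.
    incidence-bound-1 : q ≡ 1 → LtPlus (iH H) 0 (scale (c * n) (cube (β r (2 * t * q) a)))
    incidence-bound-1 q≡1 = LtPlus-coefficient {b = b} {e = 3 * e}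
      (cong (λ z → (2 ^ z) ^ 3) (m≤n⇒m∸n≡0 3≤kl)) (m^n>0 a (5 ∸ kl)) 1≤b
      (≤-trans (iH-< 0 (λ {S} _ → ≤-reflexive (inc-empty adj? S S (¬H≻F ∘ adj⇒single-edge≻ F pieces⊆edges q≡1)))
                 ≤-refl (≤-reflexive (^-zeroˡ p)))
        (≤-reflexive (*-identityʳ _)))
      where
      instance _ = >-nonZero (proj₁ alpha)
      3≤kl : 3 ≤ kl
      3≤kl = ≤-trans (s≤s (s≤s (s≤s z≤n))) (≤-trans (*-monoʳ-≤ 4 (*-mono-≤ 1≤q (m≤n+m 1 ((p ∸ 1) * (q ∸ 1))))) 4tq≤kl)

    -- From `2 ≤ q` follows `p ≤ t ≤ s`, so the power `p` of the clique count becomes a factor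
    -- `2 + s` in the exponent, giving the square in `exponent-≤`.
    incidence-bound-2 : 2 ≤ q → LtPlus (iH H) 0 (scale (c * n) (cube (β r (2 * t * q) a)))
    incidence-bound-2 2≤q = LtPlus-integral {s = 0} {b = b} {e = 3 * e}
      (cong (λ z → (2 ^ z) ^ 3) (m≤n⇒m∸n≡0 (≤-trans (m≤m+n 3 5) 8≤kl)))
      (cong (a ^_) (m≤n⇒m∸n≡0 (≤-trans (m≤m+n 5 3) 8≤kl)))
      (large a (proj₁ alpha) (proj₁ (proj₂ alpha)))
      where
      s = q * t
      p≤t : p ≤ t
      p≤t = begin
        p                       ≡⟨ sym (m∸n+n≡m 1≤p) ⟩
        (p ∸ 1) + 1             ≡⟨ cong (_+ 1) (sym (*-identityʳ (p ∸ 1))) ⟩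
        (p ∸ 1) * 1 + 1         ≤⟨ +-monoˡ-≤ 1 (*-monoʳ-≤ (p ∸ 1) (∸-monoˡ-≤ 1 2≤q)) ⟩
        t                       ∎
      p≤s : p ≤ s
      p≤s = ≤-trans (≤-reflexive (sym (*-identityˡ p))) (*-mono-≤ 1≤q p≤t)
      2≤s : 2 ≤ s
      2≤s = *-mono-≤ 2≤q (≤-trans 1≤p p≤t)
      8≤kl : 8 ≤ kl
      8≤kl = ≤-trans (*-monoʳ-≤ 4 2≤s) 4tq≤kl
      large : ∀ a → 1 ≤ a → n ≤ Ack a → iH H < c * n * coef * b ^ (3 * ((2 * a + 8) * a ^ (kl ∸ 5)))
      -- `Ack 1 = 2`, which `3 ≤ n` rules out.
      large 1             _ n≤2 = contradiction (≤-trans 3≤n n≤2) 1+n≰n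
      large (suc (suc k)) _ n≤A = iH-< (density r s a′)
        (sparse-density F ¬H≻F {t = t} {k} {n} 1≤r (≤-trans (s≤s z≤n) 2≤s) selectable v≤n n≤A)
        (m^n>0 b (3 * e′)) (begin
          (1 + density r s a′) ^ p             ≤⟨ ^-monoˡ-≤ p 1+density ⟩
          (b ^ ((2 + s) * W)) ^ p              ≡⟨ ^-*-assoc b ((2 + s) * W) p ⟩
          b ^ ((2 + s) * W * p)                ≤⟨ ^-monoʳ-≤ b (begin
            (2 + s) * W * p                      ≤⟨ *-monoʳ-≤ ((2 + s) * W) (≤-trans p≤s (m≤n+m s 2)) ⟩
            (2 + s) * W * (2 + s)                ≡⟨ swap (2 + s) W ⟩
            (2 + s) * (2 + s) * W                ≤⟨ exponent-≤ s a′ kl 2≤s (s≤s (s≤s z≤n)) 4tq≤kl ⟩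
            e′                                   ≤⟨ m≤n*m e′ 3 ⟩
            3 * e′                               ∎) ⟩
          b ^ (3 * e′)                         ∎)
        where
        a′ = 2 + k
        W = a′ ^ s
        e′ = (2 * a′ + 8) * a′ ^ (kl ∸ 5)
        swap : ∀ m w → m * w * m ≡ m * m * w
        swap = solve-∀
        1+density : 1 + density r s a′ ≤ b ^ ((2 + s) * W)
        1+density = begin
          1 + density r s a′                 ≤⟨ +-mono-≤ (m^n>0 b (suc s * W)) (density-≤ r s a′ 1≤r (≤-trans (s≤s z≤n) 2≤s)) ⟩
          b ^ (suc s * W) + b ^ (suc s * W)  ≡⟨ cong (b ^ (suc s * W) +_) (sym (+-identityʳ _)) ⟩
          2 * b ^ (suc s * W)                ≤⟨ *-monoˡ-≤ (b ^ (suc s * W)) (*-mono-≤ (m≤m+n 2 8) 1≤r) ⟩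
          b * b ^ (suc s * W)                ≤⟨ *-monoˡ-≤ (b ^ (suc s * W)) (≤-trans (≤-reflexive (sym (^-identityʳ b))) (^-monoʳ-≤ b (m^n>0 a′ s))) ⟩
          b ^ W * b ^ (suc s * W)            ≡⟨ sym (^-distribˡ-+-* b W (suc s * W)) ⟩
          b ^ ((2 + s) * W)                  ∎

    incidence-bound : LtPlus (iH H) 0 (scale (c * n) (cube (β r (2 * t * q) a)))
    incidence-bound with q ≟ 1
    ... | yes q≡1 = incidence-bound-1 q≡1
    ... | no q≢1  = incidence-bound-2 (≤∧≢⇒< 1≤q (q≢1 ∘ sym))

theorem6 : (F : StarForest) → 2 ≤ StarForest.r F →
    (∀ n → 1 ≤ n → ∀ a → IsAlpha n a → ∀ G → Hypergraph G → Simple G → IsGraph G →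
    vH G ≤ n → ¬ (G ≻ StarForest.edges F) →
    LtPlus (eH G) ((StarForest.r F ∸ 1) * n)
    (scale n (β (StarForest.r F) (2 * StarForest.q F) a)))
    × (Σ ℕ λ c → Σ ℕ λ n₀ → ∀ n → n₀ ≤ n → ∀ a → IsAlpha n a → ∀ H → Hypergraph H → Simple H →
    vH H ≤ n → ¬ (H ≻ StarForest.edges F) →
    LtPlus (eH H) 0
    (scale (c * n) (cube (β (StarForest.r F) (2 * StarForest.t F * StarForest.q F) a))))
    × (Σ ℕ λ c → Σ ℕ λ n₀ → ∀ n → n₀ ≤ n → ∀ a → IsAlpha n a → ∀ H → Hypergraph H → Simple H →
    vH H ≤ n → ¬ (H ≻ StarForest.edges F) →
    LtPlus (iH H) 0
    (scale (c * n) (cube (β (StarForest.r F) (2 * StarForest.t F * StarForest.q F) a))))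
theorem6 F 2≤r = graphs
  -- Edges are nonempty, so the bound on incidences also bounds their number, with the same
  -- constants.
  , (c , 3 , λ n 3≤n a α H hyp simple v≤n ¬H≻F →
      LtPlus-mono 0 (X n a) (Hyper.eH≤iH F H hyp simple ¬H≻F (1≤q ¬H≻F))
        (incidence-bound (1≤q ¬H≻F) n 3≤n a α H hyp simple v≤n ¬H≻F))
  , (c , 3 , λ n 3≤n a α H hyp simple v≤n ¬H≻F → incidence-bound (1≤q ¬H≻F) n 3≤n a α H hyp simple v≤n ¬H≻F)
  where
  open StarForest F
  open Bounding F 2≤r
  X : ℕ → ℕ → PowExpr
  X n a = scale (c * n) (cube (β r (2 * t * q) a))
  1≤q : ∀ {H} → ¬ (H ≻ edges) → 1 ≤ q
  1≤q ¬H≻F = n≢0⇒n>0 (¬H≻F ∘ no-edges⇒≻ F _)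
  graphs : ∀ n → 1 ≤ n → ∀ a → IsAlpha n a → ∀ G → Hypergraph G → Simple G → IsGraph G →
    vH G ≤ n → ¬ (G ≻ edges) → LtPlus (eH G) ((r ∸ 1) * n) (scale n (β r (2 * q) a))
  graphs n 1≤n a α G hyp simple graph v≤n ¬G≻F with q ≟ 1
  ... | yes q≡1 = graph-bound-1 q≡1 n 1≤n G hyp simple graph ¬G≻F (scale n (β r (2 * q) a))
  ... | no q≢1  = graph-bound (≤∧≢⇒< (1≤q ¬G≻F) (q≢1 ∘ sym)) n 1≤n a α G hyp simple graph v≤n ¬G≻F
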